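{- There exist absolute constants $c_*>0$, $K>0$ and $p_0$ such that for every prime $p\geqslant p_0$, the number $T(p)$ of ordered triples $(A,B,C)$ of subsets of $\mathbb{F}_p$ such that $x+y\neq z$ for all $x\in A$, $y\in B$, $z\in C$ satisfies $$|T(p)-3\cdot 4^p|\leqslant K(4-c_*)^p .$$
   Context: $\mathbb{F}_p$ is the field with $p$ elements, viewed as an additive group. The subsets $A,B,C$ may be empty. -}

module Defs where

open import Data.Bool.Base using (true; false)
open import Data.Fin.Base using (Fin; toℕ)
open import Data.Fin.Properties using (all?; nonZeroIndex) renaming (_≟_ to _≟ᶠ_)
open import Data.Fin.Subset using (Subset; Side; inside; outside) renaming (_∈_ to _∈ˢ_)
open import Data.Fin.Subset.Properties using (_∈?_)
open import Data.Integer.Base using (+_)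
open import Data.List.Base using (List; []; _∷_; length; filter; cartesianProduct; cartesianProductWith)
open import Data.List.Membership.Propositional using (_∈_)
open import Data.List.Membership.Propositional.Properties using (∈-cartesianProductWith⁺; ∈-cartesianProduct⁺)
open import Data.List.Relation.Unary.All using ([]; _∷_)
open import Data.List.Relation.Unary.AllPairs using ([]; _∷_)
open import Data.List.Relation.Unary.Any using (here; there)
open import Data.List.Relation.Unary.Unique.Propositional using (Unique)
open import Data.List.Relation.Unary.Unique.Propositional.Properties using (cartesianProduct⁺; cartesianProductWith⁺)
open import Data.Nat.Base using (ℕ; zero; suc; _+_)
open import Data.Nat.DivMod using (_mod_)
open import Data.Product.Base using (_×_; _,_)
open import Data.Rational.Base using (ℚ; _/_; +-*-rawSemiring)
open import Data.Vec.Base using ([]; _∷_)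
open import Data.Vec.Properties using (∷-injective)
open import Relation.Binary.PropositionalEquality.Core using (_≡_; _≢_; refl)
open import Relation.Nullary.Decidable using (Dec; ¬?; _→-dec_)

open import Algebra.Definitions.RawSemiring +-*-rawSemiring public using (_^_)

fromℕ : ℕ → ℚ
fromℕ n = + n / 1

-- 𝔽 p is only used as an additive group, so residues modulo p suffice.
𝔽 : ℕ → Set
𝔽 = Fin

infixl 6 _⊕_
_⊕_ : ∀ {p} → 𝔽 p → 𝔽 p → 𝔽 p
_⊕_ {p} x y = (toℕ x + toℕ y) mod p
  where instance _ = nonZeroIndex x

Triple : ℕ → Set
Triple p = Subset p × Subset p × Subset p

SumFree : ∀ {p} → Triple p → Set
SumFree {p} (A , B , C) =
  ∀ (x y z : 𝔽 p) → x ∈ˢ A → y ∈ˢ B → z ∈ˢ C → x ⊕ y ≢ z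

sumFree? : ∀ {p} (t : Triple p) → Dec (SumFree t)
sumFree? (A , B , C) = all? λ x → all? λ y → all? λ z →
  (x ∈? A) →-dec ((y ∈? B) →-dec ((z ∈? C) →-dec ¬? (x ⊕ y ≟ᶠ z)))

sides : List Side
sides = inside ∷ outside ∷ []

subsets : ∀ n → List (Subset n)
subsets zero    = [] ∷ []
subsets (suc n) = cartesianProductWith _∷_ sides (subsets n)

triples : ∀ p → List (Triple p)
triples p = cartesianProduct (subsets p) (cartesianProduct (subsets p) (subsets p))

T : ℕ → ℕ
T p = length (filter sumFree? (triples p))

-- T is the intended cardinality because triples lists every triple exactly once.

subsets-complete : ∀ {n} (A : Subset n) → A ∈ subsets n
subsets-complete []          = here refl
subsets-complete (true  ∷ A) = ∈-cartesianProductWith⁺ _∷_ {xs = sides} (here refl) (subsets-complete A)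
subsets-complete (false ∷ A) = ∈-cartesianProductWith⁺ _∷_ {xs = sides} (there (here refl)) (subsets-complete A)

subsets-unique : ∀ n → Unique (subsets n)
subsets-unique zero    = [] ∷ []
subsets-unique (suc n) =
  cartesianProductWith⁺ _∷_ ∷-injective (((λ ()) ∷ []) ∷ [] ∷ []) (subsets-unique n)

triples-complete : ∀ {p} (t : Triple p) → t ∈ triples p
triples-complete (A , B , C) = ∈-cartesianProduct⁺ (subsets-complete A)
  (∈-cartesianProduct⁺ (subsets-complete B) (subsets-complete C))

triples-unique : ∀ p → Unique (triples p)
triples-unique p = cartesianProduct⁺ (subsets-unique p)
  (cartesianProduct⁺ (subsets-unique p) (subsets-unique p))

{-# OPTIONS --safe #-}

-- Exactly 4^p triples have A = ∅, and likewise for B and C; two of the sets are empty in only 2^p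
-- triples for each pair. It remains to see that triples of nonempty sets are negligible, and this
-- holds for every Latin square x ∙ y on n points in place of x + y.
--
-- If |A| ≤ n/16, one x ∈ A already restricts (B , C) to 3^n pairs, since C misses x ∙ B.
-- If n/16 ≤ |A| ≤ 3n/7, choose greedily boundedly many y ∈ B so that Q = A ∙ S, for the chosen set S,
-- contains nearly all of A ∙ y for every y ∈ B. Double counting shows that at most |Q| + εn points y
-- have this property, and C misses Q, so A leaves at most n^O(1) 2^((1+ε)n) pairs; there are few
-- enough sets A with |A| ≤ 3n/7. The conjugate Latin squares exchange the roles of A, B and C.
-- If all three sets have more than 3n/7 points, then B together with some x ∈ A and z ∈ C confines C
-- and A to sets of size n − |B| ≤ 4n/7, of which they are unusually large subsets.
module Submission where

open import Defs hiding (_^_)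
open import Algebra.Bundles using (CommutativeRing)
open import Data.Bool.Base using (if_then_else_)
open import Data.Empty using (⊥-elim)
open import Data.Fin.Base using (Fin)
import Data.Fin.Properties as Fin
import Data.Integer.Base as ℤ
import Data.Integer.Properties as ℤ
open import Data.List.Base using (List; []; _∷_; _++_; map; length; filter; tabulate; allFin; cartesianProduct; cartesianProductWith)
open import Data.List.Membership.Propositional.Properties using (∈-cartesianProductWith⁺; ∈-allFin)
open import Data.List.Properties using (length-tabulate)
open import Data.List.Relation.Unary.Any using (here; there)
open import Data.Nat.Base as ℕ using (ℕ; zero; suc) renaming (_≥_ to _≥ⁿ_)
open import Data.Nat.Primality using (Prime; prime⇒nonZero)
import Data.Nat.Properties as ℕ
open import Data.Nat.Tactic.RingSolver using (solve-∀)
open import Data.Product.Base using (Σ-syntax; ∃-syntax; ∃; _×_; _,_; proj₁)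
import Data.Rational.Properties as ℚ
import Data.Rational.Unnormalised.Base as ℚᵘ
import Data.Rational.Unnormalised.Properties as ℚᵘ
open import Data.Sum.Base using (_⊎_; inj₁; inj₂)
import Data.Vec.Base as Vec
open import Data.Vec.Properties using (lookup∘tabulate; lookup⇒[]=; []=⇒lookup)
open import Data.Vec.Relation.Unary.All using (All; []; _∷_)
open import Function.Base using (_∘_; id; flip)
open import Level using (Level)
open import Relation.Binary.PropositionalEquality
open import Relation.Nullary.Decidable using (Dec; yes; no; does; dec-true; _×-dec_; _→-dec_; ¬?)
open import Relation.Nullary.Negation using (¬_; contradiction)

module Counting where
  open import Data.Fin.Base using (zero; suc; toℕ)
  open import Data.Fin.Permutation using (permutation)
  open import Data.Fin.Subset using (Subset; inside; outside; ∣_∣; ∁; _⊆_; ⊥; _∪_; Nonempty) renaming (_∈_ to _∈ˢ_; _∉_ to _∉ˢ_)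
  open import Data.Fin.Subset.Properties
  open import Data.List.Membership.Propositional using (_∈_)
  open import Data.Nat.Base
  open import Data.Nat.DivMod
  open import Data.Nat.Properties
  open import Data.Vec.Base using (Vec; []; _∷_)
  open import Algebra.Properties.CommutativeMonoid.Sum +-0-commutativeMonoid using (sum; sum-permute)
  open import Algebra.Properties.CommutativeSemigroup +-commutativeSemigroup using () renaming (interchange to +-interchange)
  open import Algebra.Properties.CommutativeSemigroup *-commutativeSemigroup using (x∙yz≈y∙xz; xy∙z≈xz∙y) renaming (interchange to *-interchange)

  private variable
    ℓ ℓ₁ ℓ₂ : Level
    X : Set ℓ
    Y : Set ℓ₁
    P : Set ℓ₂
    n k : ℕ

  -- Finite sums

  ∑ : List X → (X → ℕ) → ℕ
  ∑ []       f = 0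
  ∑ (x ∷ xs) f = f x + ∑ xs f

  ∑-mono : ∀ (xs : List X) {f g : X → ℕ} → (∀ x → f x ≤ g x) → ∑ xs f ≤ ∑ xs g
  ∑-mono []       f≤g = z≤n
  ∑-mono (x ∷ xs) f≤g = +-mono-≤ (f≤g x) (∑-mono xs f≤g)

  ∑-cong : ∀ (xs : List X) {f g : X → ℕ} → (∀ x → f x ≡ g x) → ∑ xs f ≡ ∑ xs g
  ∑-cong []       f≡g = refl
  ∑-cong (x ∷ xs) f≡g = cong₂ _+_ (f≡g x) (∑-cong xs f≡g)

  ∑-+ : ∀ (xs : List X) (f g : X → ℕ) → ∑ xs (λ x → f x + g x) ≡ ∑ xs f + ∑ xs g
  ∑-+ []       f g = refl
  ∑-+ (x ∷ xs) f g = trans (cong (f x + g x +_) (∑-+ xs f g)) (+-interchange (f x) (g x) _ _)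

  ∑-*ˡ : ∀ (xs : List X) c (f : X → ℕ) → ∑ xs (λ x → c * f x) ≡ c * ∑ xs f
  ∑-*ˡ []       c f = sym (*-zeroʳ c)
  ∑-*ˡ (x ∷ xs) c f = trans (cong (c * f x +_) (∑-*ˡ xs c f)) (sym (*-distribˡ-+ c (f x) _))

  ∑-*ʳ : ∀ (xs : List X) c (f : X → ℕ) → ∑ xs (λ x → f x * c) ≡ ∑ xs f * c
  ∑-*ʳ xs c f = trans (∑-cong xs λ x → *-comm (f x) c) (trans (∑-*ˡ xs c f) (*-comm c _))

  ∑-const : ∀ (xs : List X) c → ∑ xs (λ _ → c) ≡ length xs * c
  ∑-const []       c = refl
  ∑-const (x ∷ xs) c = cong (c +_) (∑-const xs c)

  ∑-swap : ∀ (xs : List X) (ys : List Y) (f : X → Y → ℕ) →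
           ∑ xs (λ x → ∑ ys (f x)) ≡ ∑ ys (λ y → ∑ xs (λ x → f x y))
  ∑-swap []       ys f = sym (trans (∑-const ys 0) (*-zeroʳ (length ys)))
  ∑-swap (x ∷ xs) ys f = trans (cong (∑ ys (f x) +_) (∑-swap xs ys f)) (sym (∑-+ ys (f x) _))

  ∑-∑-product : ∀ (xs : List X) (ys : List Y) (f : X → ℕ) (g : Y → ℕ) →
                ∑ xs (λ x → ∑ ys λ y → f x * g y) ≡ ∑ xs f * ∑ ys g
  ∑-∑-product xs ys f g = trans (∑-cong xs λ x → ∑-*ˡ ys (f x) g) (∑-*ʳ xs (∑ ys g) f)

  ∑-++ : ∀ (xs ys : List X) (f : X → ℕ) → ∑ (xs ++ ys) f ≡ ∑ xs f + ∑ ys f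
  ∑-++ []       ys f = refl
  ∑-++ (x ∷ xs) ys f = trans (cong (f x +_) (∑-++ xs ys f)) (sym (+-assoc (f x) _ _))

  ∑-map : ∀ (g : X → Y) (xs : List X) (f : Y → ℕ) → ∑ (map g xs) f ≡ ∑ xs (f ∘ g)
  ∑-map g []       f = refl
  ∑-map g (x ∷ xs) f = cong (f (g x) +_) (∑-map g xs f)

  ∑-cartesianProductWith : ∀ {c} {Z : Set c} (g : X → Y → Z) (xs : List X) (ys : List Y) (f : Z → ℕ) →
    ∑ (cartesianProductWith g xs ys) f ≡ ∑ xs (λ x → ∑ ys (f ∘ g x))
  ∑-cartesianProductWith g []       ys f = refl
  ∑-cartesianProductWith g (x ∷ xs) ys f =
    trans (∑-++ (map (g x) ys) _ f) (cong₂ _+_ (∑-map (g x) ys f) (∑-cartesianProductWith g xs ys f))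

  term≤∑ : ∀ {xs : List X} {x} (f : X → ℕ) → x ∈ xs → f x ≤ ∑ xs f
  term≤∑ f (here refl) = m≤m+n _ _
  term≤∑ f (there x∈xs) = m≤n⇒m≤o+n _ (term≤∑ f x∈xs)

  -- Indicators and counting of points

  𝟙 : Dec P → ℕ
  𝟙 d = if does d then 1 else 0

  𝟙≤ : ∀ (d : Dec P) {k} → (P → 1 ≤ k) → 𝟙 d ≤ k
  𝟙≤ (yes p) h = h p
  𝟙≤ (no _)  h = z≤n

  𝟙-true : ∀ (d : Dec P) → P → 𝟙 d ≡ 1
  𝟙-true (yes _) _ = refl
  𝟙-true (no ¬p) p = contradiction p ¬p

  𝟙-* : ∀ (d : Dec P) {j k} → (P → j ≤ k) → 𝟙 d * j ≤ k
  𝟙-* (yes p) {j} h = ≤-trans (≤-reflexive (*-identityˡ j)) (h p)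
  𝟙-* (no _)      h = z≤n

  length-filter : ∀ {P : X → Set ℓ₂} (P? : ∀ x → Dec (P x)) xs → length (filter P? xs) ≡ ∑ xs (𝟙 ∘ P?)
  length-filter P? []       = refl
  length-filter P? (x ∷ xs) with P? x
  ... | yes _ = cong suc (length-filter P? xs)
  ... | no  _ = length-filter P? xs

  points : ∀ n → List (Fin n)
  points = allFin

  ∑-tabulate : ∀ (g : Fin n → X) (f : X → ℕ) → ∑ (tabulate g) f ≡ sum (f ∘ g)
  ∑-tabulate {n = zero}  g f = refl
  ∑-tabulate {n = suc n} g f = cong (f (g zero) +_) (∑-tabulate (g ∘ suc) f)

  ∑-reindex : ∀ (π π⁻¹ : Fin n → Fin n) → (∀ y → π (π⁻¹ y) ≡ y) → (∀ x → π⁻¹ (π x) ≡ x) →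
              ∀ f → ∑ (points n) (f ∘ π) ≡ ∑ (points n) f
  ∑-reindex {n} π π⁻¹ l r f =
    trans (∑-tabulate id (f ∘ π)) (sym (trans (∑-tabulate id f) (sum-permute f (permutation π π⁻¹ l r))))

  ∣∣-∑ : ∀ (A : Subset n) → ∣ A ∣ ≡ ∑ (points n) (λ i → 𝟙 (i ∈? A))
  ∣∣-∑ A = trans (go A) (sym (∑-tabulate id (λ i → 𝟙 (i ∈? A))))
    where
    go : ∀ {n} (A : Subset n) → ∣ A ∣ ≡ sum (λ i → 𝟙 (i ∈? A))
    go []            = refl
    go (inside  ∷ A) = cong suc (go A)
    go (outside ∷ A) = go A

  -- Weighted sums over all subsets

  ∑-subsets : ∀ n (f : Subset (suc n) → ℕ) →
              ∑ (subsets (suc n)) f ≡ ∑ (subsets n) (f ∘ (inside ∷_)) + ∑ (subsets n) (f ∘ (outside ∷_))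
  ∑-subsets n f = trans (∑-cartesianProductWith _∷_ sides (subsets n) f)
    (cong (∑ (subsets n) (f ∘ (inside ∷_)) +_) (+-identityʳ _))

  -- Deciding whether the first point lies in `A` splits off a factor u + v. Besides exact counts,
  -- this supplies the generating function behind Chernoff's bound.
  ∑-binomial : ∀ n u v → ∑ (subsets n) (λ A → u ^ ∣ A ∣ * v ^ ∣ ∁ A ∣) ≡ (u + v) ^ n
  ∑-binomial zero    u v = refl
  ∑-binomial (suc n) u v = begin
    ∑ (subsets (suc n)) f                                      ≡⟨ ∑-subsets n f ⟩
    ∑ (subsets n) (λ A → u * u ^ ∣ A ∣ * v ^ ∣ ∁ A ∣) + ∑ (subsets n) (λ A → u ^ ∣ A ∣ * (v * v ^ ∣ ∁ A ∣))
      ≡⟨ cong₂ _+_ (∑-cong (subsets n) λ A → *-assoc u (u ^ ∣ A ∣) (v ^ ∣ ∁ A ∣))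
                   (∑-cong (subsets n) λ A → x∙yz≈y∙xz (u ^ ∣ A ∣) v (v ^ ∣ ∁ A ∣)) ⟩
    ∑ (subsets n) (λ A → u * g A) + ∑ (subsets n) (λ A → v * g A)
      ≡⟨ cong₂ _+_ (∑-*ˡ (subsets n) u g) (∑-*ˡ (subsets n) v g) ⟩
    u * ∑ (subsets n) g + v * ∑ (subsets n) g                  ≡⟨ *-distribʳ-+ (∑ (subsets n) g) u v ⟨
    (u + v) * ∑ (subsets n) g                                  ≡⟨ cong ((u + v) *_) (∑-binomial n u v) ⟩
    (u + v) ^ suc n                                            ∎
    where
    open ≡-Reasoning
    f : Subset (suc n) → ℕ
    f A = u ^ ∣ A ∣ * v ^ ∣ ∁ A ∣
    g : Subset n → ℕ
    g A = u ^ ∣ A ∣ * v ^ ∣ ∁ A ∣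

  -- A point of `X` contributes t if chosen and 1 if not; a point outside `X` is never chosen. The
  -- weight t = 1 counts subsets, and t = 3 later rewards large ones.
  ∑-powerset : ∀ (X : Subset n) t → ∑ (subsets n) (λ A → 𝟙 (A ⊆? X) * t ^ ∣ A ∣) ≡ suc t ^ ∣ X ∣
  ∑-powerset []            t = refl
  ∑-powerset {suc n} (inside ∷ X) t = begin
    ∑ (subsets (suc n)) (λ A → 𝟙 (A ⊆? (inside ∷ X)) * t ^ ∣ A ∣)
      ≡⟨ ∑-subsets n (λ A → 𝟙 (A ⊆? (inside ∷ X)) * t ^ ∣ A ∣) ⟩
    ∑ (subsets n) (λ A → 𝟙 (A ⊆? X) * (t * t ^ ∣ A ∣)) + ∑ (subsets n) g
      ≡⟨ cong (_+ ∑ (subsets n) g) (trans (∑-cong (subsets n) λ A → x∙yz≈y∙xz (𝟙 (A ⊆? X)) t (t ^ ∣ A ∣))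
                                          (∑-*ˡ (subsets n) t g)) ⟩
    t * ∑ (subsets n) g + ∑ (subsets n) g                   ≡⟨ +-comm (t * ∑ (subsets n) g) _ ⟩
    suc t * ∑ (subsets n) g                                 ≡⟨ cong (suc t *_) (∑-powerset X t) ⟩
    suc t ^ suc ∣ X ∣                                        ∎
    where
    open ≡-Reasoning
    g : Subset n → ℕ
    g A = 𝟙 (A ⊆? X) * t ^ ∣ A ∣
  ∑-powerset {suc n} (outside ∷ X) t =
    trans (∑-subsets n (λ A → 𝟙 (A ⊆? (outside ∷ X)) * t ^ ∣ A ∣))
      (cong₂ _+_ (trans (∑-const (subsets n) 0) (*-zeroʳ (length (subsets n)))) (∑-powerset X t))

  tuples : ∀ n k → List (Vec (Fin n) k)
  tuples n zero    = [] ∷ []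
  tuples n (suc k) = cartesianProductWith _∷_ (points n) (tuples n k)

  𝟙-cong : ∀ {a b} {P : Set a} {Q : Set b} (d : Dec P) (e : Dec Q) → (P → Q) → (Q → P) → 𝟙 d ≡ 𝟙 e
  𝟙-cong (yes p) e f g = sym (𝟙-true e (f p))
  𝟙-cong (no ¬p) (yes q) f g = contradiction (g q) ¬p
  𝟙-cong (no ¬p) (no _)  f g = refl

  𝟙-*-mono : ∀ {a} {P : Set a} (d : Dec P) {j k} → (P → j ≤ k) → 𝟙 d * j ≤ 𝟙 d * k
  𝟙-*-mono (yes p) h = *-monoʳ-≤ 1 (h p)
  𝟙-*-mono (no _)  h = z≤n

  ∑-points-const : ∀ n c → ∑ (points n) (λ _ → c) ≡ n * c
  ∑-points-const n c = trans (∑-const (points n) c) (cong (_* c) (length-tabulate {n = n} id))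

  ∑-tuples-const : ∀ n k c → ∑ (tuples n k) (λ _ → c) ≡ n ^ k * c
  ∑-tuples-const n zero    c = refl
  ∑-tuples-const n (suc k) c = begin
    ∑ (tuples n (suc k)) (λ _ → c)                       ≡⟨ ∑-cartesianProductWith _∷_ (points n) (tuples n k) _ ⟩
    ∑ (points n) (λ _ → ∑ (tuples n k) (λ _ → c))        ≡⟨ ∑-points-const n _ ⟩
    n * ∑ (tuples n k) (λ _ → c)                         ≡⟨ cong (n *_) (∑-tuples-const n k c) ⟩
    n * (n ^ k * c)                                      ≡⟨ *-assoc n (n ^ k) c ⟨
    n ^ suc k * c                                        ∎
    where open ≡-Reasoning

  tuples-complete : (S : Vec (Fin n) k) → S ∈ tuples n k
  tuples-complete []      = here refl
  tuples-complete (x ∷ S) = ∈-cartesianProductWith⁺ _∷_ (∈-allFin x) (tuples-complete S)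

  ∑-powerset₁ : ∀ (X : Subset n) → ∑ (subsets n) (λ A → 𝟙 (A ⊆? X)) ≡ 2 ^ ∣ X ∣
  ∑-powerset₁ {n} X = trans (∑-cong (subsets n) λ A → sym (trans (cong (𝟙 (A ⊆? X) *_) (^-zeroˡ ∣ A ∣)) (*-identityʳ _)))
    (∑-powerset X 1)

  ∣A∣+∣∁A∣≡n : (A : Subset n) → ∣ A ∣ + ∣ ∁ A ∣ ≡ n
  ∣A∣+∣∁A∣≡n A = trans (cong (∣ A ∣ +_) (∣∁p∣≡n∸∣p∣ A)) (m+[n∸m]≡n (∣p∣≤n A))

  comprehension : {P : Fin n → Set} → (∀ i → Dec (P i)) → Subset n
  comprehension P? = Vec.tabulate (does ∘ P?)

  ∈-comprehension⁺ : ∀ {P : Fin n → Set} (P? : ∀ i → Dec (P i)) {i} → P i → i ∈ˢ comprehension P?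
  ∈-comprehension⁺ P? {i} p = lookup⇒[]= i _ (trans (lookup∘tabulate (does ∘ P?) i) (dec-true (P? i) p))

  ∈-comprehension⁻ : ∀ {P : Fin n → Set} (P? : ∀ i → Dec (P i)) {i} → i ∈ˢ comprehension P? → P i
  ∈-comprehension⁻ P? {i} i∈ with P? i | trans (sym (lookup∘tabulate (does ∘ P?) i)) ([]=⇒lookup i∈)
  ... | yes p | _ = p

  𝟙-comprehension : ∀ {P : Fin n → Set} (P? : ∀ i → Dec (P i)) i → 𝟙 (i ∈? comprehension P?) ≡ 𝟙 (P? i)
  𝟙-comprehension P? i = 𝟙-cong (i ∈? comprehension P?) (P? i) (∈-comprehension⁻ P?) (∈-comprehension⁺ P?)

  -- Sums over triples of subsets

  ∑³ : ∀ n → (Subset n → Subset n → Subset n → ℕ) → ℕ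
  ∑³ n φ = ∑ (subsets n) λ A → ∑ (subsets n) λ B → ∑ (subsets n) λ C → φ A B C

  ∑³-mono : ∀ n {φ ψ} → (∀ A B C → φ A B C ≤ ψ A B C) → ∑³ n φ ≤ ∑³ n ψ
  ∑³-mono n φ≤ψ = ∑-mono (subsets n) λ A → ∑-mono (subsets n) λ B → ∑-mono (subsets n) λ C → φ≤ψ A B C

  ∑³-+ : ∀ n φ ψ → ∑³ n (λ A B C → φ A B C + ψ A B C) ≡ ∑³ n φ + ∑³ n ψ
  ∑³-+ n φ ψ = trans
    (∑-cong (subsets n) λ A → trans (∑-cong (subsets n) λ B → ∑-+ (subsets n) (φ A B) (ψ A B)) (∑-+ (subsets n) _ _))
    (∑-+ (subsets n) _ _)

  ∑³-swap₁₂ : ∀ n φ → ∑³ n (λ A B C → φ B A C) ≡ ∑³ n φ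
  ∑³-swap₁₂ n φ = ∑-swap (subsets n) (subsets n) λ A B → ∑ (subsets n) (φ B A)

  ∑³-swap₂₃ : ∀ n φ → ∑³ n (λ A B C → φ A C B) ≡ ∑³ n φ
  ∑³-swap₂₃ n φ = ∑-cong (subsets n) λ A → ∑-swap (subsets n) (subsets n) λ B C → φ A C B

  ∑³-swap₁₃ : ∀ n φ → ∑³ n (λ A B C → φ C B A) ≡ ∑³ n φ
  ∑³-swap₁₃ n φ = trans (∑³-swap₁₂ n λ A B C → φ C A B)
    (trans (∑³-swap₂₃ n λ A B C → φ B A C) (∑³-swap₁₂ n φ))

  -- Exponential rates

  ^-distribʳ-* : ∀ m n o → (m * n) ^ o ≡ m ^ o * n ^ o
  ^-distribʳ-* m n zero    = refl
  ^-distribʳ-* m n (suc o) = trans (cong (m * n *_) (^-distribʳ-* m n o)) (*-interchange m n _ _)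

  ^-exchange : ∀ m n o → (m ^ n) ^ o ≡ (m ^ o) ^ n
  ^-exchange m n o = trans (^-*-assoc m n o) (trans (cong (m ^_) (*-comm n o)) (sym (^-*-assoc m o n)))

  ^-cancelˡ-≤ : ∀ k .{{_ : NonZero k}} {x y} → x ^ k ≤ y ^ k → x ≤ y
  ^-cancelˡ-≤ k h = ≮⇒≥ λ y<x → <⇒≱ (^-monoˡ-< k y<x) h

  -- For b > 0, division by b^(n+1) turns this into 1 + n/b ≤ (1 + 1/b)^n; the cleared form stays
  -- within ℕ.
  bernoulli : ∀ b n → (b + n) * b ^ n ≤ b * suc b ^ n
  bernoulli b zero    = ≤-reflexive (cong (_* 1) (+-identityʳ b))
  bernoulli b (suc n) = begin
    (b + suc n) * (b * b ^ n)       ≡⟨ *-assoc (b + suc n) b _ ⟨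
    (b + suc n) * b * b ^ n         ≤⟨ *-monoˡ-≤ (b ^ n) (≤-trans (m≤m+n _ n) (≤-reflexive (expand b n))) ⟩
    suc b * (b + n) * b ^ n         ≡⟨ *-assoc (suc b) (b + n) _ ⟩
    suc b * ((b + n) * b ^ n)       ≤⟨ *-monoʳ-≤ (suc b) (bernoulli b n) ⟩
    suc b * (b * suc b ^ n)         ≡⟨ x∙yz≈y∙xz (suc b) b _ ⟩
    b * (suc b * suc b ^ n)         ∎
    where
    open ≤-Reasoning
    expand : ∀ b n → (b + suc n) * b + n ≡ suc b * (b + n)
    expand = solve-∀

  linear≤exponential : ∀ b n → n * b ^ n ≤ b * suc b ^ n
  linear≤exponential b n = ≤-trans (*-monoˡ-≤ (b ^ n) (m≤n+m n b)) (bernoulli b n)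

  -- Bernoulli's inequality gives 2 ≤ (1 + 1/m)^m, so every block of m factors pays for one factor
  -- 2, and me ≤ n provides e such blocks.
  2^e*m^n≤[1+m]^n : ∀ m .{{_ : NonZero m}} {e n} → m * e ≤ n → 2 ^ e * m ^ n ≤ suc m ^ n
  2^e*m^n≤[1+m]^n m {e} {n} me≤n = begin
    2 ^ e * m ^ n                       ≡⟨ cong (λ k → 2 ^ e * m ^ k) (m+[n∸m]≡n me≤n) ⟨
    2 ^ e * m ^ (m * e + r)             ≡⟨ cong (2 ^ e *_) (^-distribˡ-+-* m (m * e) r) ⟩
    2 ^ e * (m ^ (m * e) * m ^ r)       ≡⟨ *-assoc (2 ^ e) _ _ ⟨
    2 ^ e * m ^ (m * e) * m ^ r         ≡⟨ cong (λ k → 2 ^ e * k * m ^ r) (^-*-assoc m m e) ⟨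
    2 ^ e * (m ^ m) ^ e * m ^ r         ≡⟨ cong (_* m ^ r) (^-distribʳ-* 2 (m ^ m) e) ⟨
    (2 * m ^ m) ^ e * m ^ r             ≤⟨ *-mono-≤ (^-monoˡ-≤ e doubling) (^-monoˡ-≤ r (n≤1+n m)) ⟩
    (suc m ^ m) ^ e * suc m ^ r         ≡⟨ cong (_* suc m ^ r) (^-*-assoc (suc m) m e) ⟩
    suc m ^ (m * e) * suc m ^ r         ≡⟨ ^-distribˡ-+-* (suc m) (m * e) r ⟨
    suc m ^ (m * e + r)                 ≡⟨ cong (suc m ^_) (m+[n∸m]≡n me≤n) ⟩
    suc m ^ n                           ∎
    where
    open ≤-Reasoning
    r : ℕ
    r = n ∸ m * e
    double : ∀ m x → m * (2 * x) ≡ (m + m) * x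
    double = solve-∀
    doubling : 2 * m ^ m ≤ suc m ^ m
    doubling = *-cancelˡ-≤ m (≤-trans (≤-reflexive (double m (m ^ m))) (bernoulli m m))

  -- Chernoff's bound: the weight u^a v^b decreases in a, and a ≤ rn/(r + s).
  D^n≤u^a*v^b : ∀ {D u v} r s .{{_ : NonZero (r + s)}} {a b n} → u ≤ v → D ^ (r + s) ≤ u ^ r * v ^ s →
                (r + s) * a ≤ r * n → a + b ≡ n → D ^ n ≤ u ^ a * v ^ b
  D^n≤u^a*v^b {D} {u} {v} r s {a} {b} {n} u≤v D≤ qa≤rn a+b≡n = ^-cancelˡ-≤ q (begin
    (D ^ n) ^ q                               ≡⟨ ^-exchange D n q ⟩
    (D ^ q) ^ n                               ≤⟨ ^-monoˡ-≤ n D≤ ⟩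
    (u ^ r * v ^ s) ^ n                       ≡⟨ ^-distribʳ-* (u ^ r) (v ^ s) n ⟩
    (u ^ r) ^ n * (v ^ s) ^ n                 ≡⟨ cong₂ _*_ (^-*-assoc u r n) (^-*-assoc v s n) ⟩
    u ^ (r * n) * v ^ (s * n)                 ≡⟨ cong (λ k → u ^ k * v ^ (s * n)) (m+[n∸m]≡n qa≤rn) ⟨
    u ^ (q * a + e) * v ^ (s * n)             ≡⟨ cong (_* v ^ (s * n)) (^-distribˡ-+-* u (q * a) e) ⟩
    -- The slack e in qa ≤ rn moves from the base u to the base v ≥ u. As a + b = n, the exponent of
    -- v then becomes exactly qb.
    u ^ (q * a) * u ^ e * v ^ (s * n)         ≤⟨ *-monoˡ-≤ (v ^ (s * n)) (*-monoʳ-≤ (u ^ (q * a)) (^-monoˡ-≤ e u≤v)) ⟩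
    u ^ (q * a) * v ^ e * v ^ (s * n)         ≡⟨ *-assoc (u ^ (q * a)) _ _ ⟩
    u ^ (q * a) * (v ^ e * v ^ (s * n))       ≡⟨ cong (u ^ (q * a) *_) (^-distribˡ-+-* v e (s * n)) ⟨
    u ^ (q * a) * v ^ (e + s * n)             ≡⟨ cong (λ k → u ^ (q * a) * v ^ k) e+sn≡qb ⟩
    u ^ (q * a) * v ^ (q * b)                 ≡⟨ cong₂ _*_ (^-power u a) (^-power v b) ⟩
    (u ^ a) ^ q * (v ^ b) ^ q                 ≡⟨ ^-distribʳ-* (u ^ a) (v ^ b) q ⟨
    (u ^ a * v ^ b) ^ q                       ∎)
    where
    open ≤-Reasoning
    q e : ℕ
    q = r + s
    e = r * n ∸ q * a
    ^-power : ∀ x k → x ^ (q * k) ≡ (x ^ k) ^ q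
    ^-power x k = trans (cong (x ^_) (*-comm q k)) (sym (^-*-assoc x k q))
    e+sn≡qb : e + s * n ≡ q * b
    e+sn≡qb = +-cancelˡ-≡ (q * a) _ _ (begin-equality
      q * a + (e + s * n)  ≡⟨ +-assoc (q * a) e _ ⟨
      q * a + e + s * n    ≡⟨ cong (_+ s * n) (m+[n∸m]≡n qa≤rn) ⟩
      r * n + s * n        ≡⟨ *-distribʳ-+ n r s ⟨
      q * n                ≡⟨ cong (q *_) a+b≡n ⟨
      q * (a + b)          ≡⟨ *-distribˡ-+ q a b ⟩
      q * a + q * b        ∎)

  -- Each factor n is absorbed by raising the base by one, at the price of the previous base as a
  -- constant factor.
  polynomial≤exponential : ∀ k b → ∃[ K ] ∀ n → n ^ k * b ^ n ≤ K * (k + b) ^ n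
  polynomial≤exponential zero    b = 1 , λ n → ≤-refl
  polynomial≤exponential (suc k) b with polynomial≤exponential k b
  ... | K , ih = K * (k + b) , λ n → begin
    n * n ^ k * b ^ n                    ≡⟨ *-assoc n _ _ ⟩
    n * (n ^ k * b ^ n)                  ≤⟨ *-monoʳ-≤ n (ih n) ⟩
    n * (K * (k + b) ^ n)                ≡⟨ x∙yz≈y∙xz n K _ ⟩
    K * (n * (k + b) ^ n)                ≤⟨ *-monoʳ-≤ K (linear≤exponential (k + b) n) ⟩
    K * ((k + b) * suc (k + b) ^ n)      ≡⟨ *-assoc K (k + b) _ ⟨
    K * (k + b) * suc (k + b) ^ n        ∎
    where open ≤-Reasoning

  -- The ratio of the two bases is brought down to (1 + b) / b by scaling b by the degree.
  polynomial-absorption : ∀ k b → ∃[ K ] ∀ n → n ^ suc k * b ^ n ≤ K * suc b ^ n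
  polynomial-absorption k b with polynomial≤exponential (suc k) (suc k * b)
  ... | K , h = K , λ n → *-cancelˡ-≤ (suc k ^ n) {{m^n≢0 (suc k) n}} (begin
    suc k ^ n * (n ^ suc k * b ^ n)      ≡⟨ x∙yz≈y∙xz (suc k ^ n) (n ^ suc k) (b ^ n) ⟩
    n ^ suc k * (suc k ^ n * b ^ n)      ≡⟨ cong (n ^ suc k *_) (^-distribʳ-* (suc k) b n) ⟨
    n ^ suc k * (suc k * b) ^ n          ≤⟨ h n ⟩
    K * (suc k + suc k * b) ^ n          ≡⟨ cong (λ x → K * x ^ n) (*-suc (suc k) b) ⟨
    K * (suc k * suc b) ^ n              ≡⟨ cong (K *_) (^-distribʳ-* (suc k) (suc b) n) ⟩
    K * (suc k ^ n * suc b ^ n)          ≡⟨ x∙yz≈y∙xz K (suc k ^ n) (suc b ^ n) ⟩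
    suc k ^ n * (K * suc b ^ n)          ∎)
    where open ≤-Reasoning

  -- Functions exponentially smaller than 4^n

  module _ {a} {I : Set a} (size : I → ℕ) where

    -- f i ≤ K (4 − 1/(1 + d)) ^ size i
    record Negligible (f : I → ℕ) : Set a where
      constructor negligible
      field
        d K   : ℕ
        bound : ∀ i → f i * suc d ^ size i ≤ K * (3 + 4 * d) ^ size i

    negligible-≤ : ∀ {f g} → (∀ i → f i ≤ g i) → Negligible g → Negligible f
    negligible-≤ f≤g (negligible d K h) = negligible d K λ i → ≤-trans (*-monoˡ-≤ (suc d ^ size i) (f≤g i)) (h i)

    -- The constants `d` and `K` serve all indices at once, so a bound valid for every Latin square
    -- transfers to the conjugates of each.
    negligible-∘ : (φ : I → I) → (∀ i → size (φ i) ≡ size i) → ∀ {f} → Negligible f → Negligible (f ∘ φ)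
    negligible-∘ φ size∘φ {f} (negligible d K h) = negligible d K λ i →
      subst (λ n → f (φ i) * suc d ^ n ≤ K * (3 + 4 * d) ^ n) (size∘φ i) (h (φ i))

    -- The common rate has denominator (1 + d)(1 + e) = 1 + (e + d(1 + e)). Its reciprocal is at
    -- most that of either denominator, so the new rate dominates both old ones.
    negligible-+ : ∀ {f g} → Negligible f → Negligible g → Negligible (λ i → f i + g i)
    negligible-+ {f} {g} (negligible d K hf) (negligible e L hg) = negligible (e + d * suc e) (K + L) λ i → begin
      (f i + g i) * (suc d * suc e) ^ size i    ≡⟨ *-distribʳ-+ _ (f i) (g i) ⟩
      f i * (suc d * suc e) ^ size i + g i * (suc d * suc e) ^ size i
        ≤⟨ +-mono-≤ (refine f d e K hf i (bound d e))
                    (≤-trans (≤-reflexive (cong (λ x → g i * x ^ size i) (*-comm (suc d) (suc e))))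
                             (refine g e d L hg i (bound′ d e))) ⟩
      K * (3 + 4 * (e + d * suc e)) ^ size i + L * (3 + 4 * (e + d * suc e)) ^ size i
        ≡⟨ *-distribʳ-+ _ K L ⟨
      (K + L) * (3 + 4 * (e + d * suc e)) ^ size i ∎
      where
      open ≤-Reasoning
      identity : ∀ d e → (3 + 4 * d) * suc e + e ≡ 3 + 4 * (e + d * suc e)
      identity = solve-∀
      identity′ : ∀ d e → (3 + 4 * e) * suc d + d ≡ 3 + 4 * (e + d * suc e)
      identity′ = solve-∀
      bound : ∀ d e → (3 + 4 * d) * suc e ≤ 3 + 4 * (e + d * suc e)
      bound d e = ≤-trans (m≤m+n _ e) (≤-reflexive (identity d e))
      bound′ : ∀ d e → (3 + 4 * e) * suc d ≤ 3 + 4 * (e + d * suc e)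
      bound′ d e = ≤-trans (m≤m+n _ d) (≤-reflexive (identity′ d e))
      refine : ∀ f d e K → (∀ i → f i * suc d ^ size i ≤ K * (3 + 4 * d) ^ size i) →
               ∀ i {E} → (3 + 4 * d) * suc e ≤ E →
               f i * (suc d * suc e) ^ size i ≤ K * E ^ size i
      refine f d e K h i {E} E≥ = let n = size i in begin
        f i * (suc d * suc e) ^ n             ≡⟨ cong (f i *_) (^-distribʳ-* (suc d) (suc e) n) ⟩
        f i * (suc d ^ n * suc e ^ n)         ≡⟨ *-assoc (f i) _ _ ⟨
        f i * suc d ^ n * suc e ^ n           ≤⟨ *-monoˡ-≤ (suc e ^ n) (h i) ⟩
        K * (3 + 4 * d) ^ n * suc e ^ n       ≡⟨ *-assoc K _ _ ⟩
        K * ((3 + 4 * d) ^ n * suc e ^ n)     ≡⟨ cong (K *_) (^-distribʳ-* (3 + 4 * d) (suc e) n) ⟨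
        K * ((3 + 4 * d) * suc e) ^ n         ≤⟨ *-monoʳ-≤ K (^-monoˡ-≤ n E≥) ⟩
        K * E ^ n                             ∎

    -- Doubling numerator and denominator of E/(1 + D) opens an integer gap: E < 4(1 + D) gives 2E +
    -- 1 ≤ 8(1 + D) - 1, and the step from 2E to 2E + 1 absorbs the polynomial.
    polynomial*exponential-negligible : ∀ {f} k D {E} → E < 4 * suc D →
      (∀ i → f i * suc D ^ size i ≤ size i ^ suc k * E ^ size i) → Negligible f
    polynomial*exponential-negligible {f} k D {E} E<4D h with polynomial-absorption k (2 * E)
    ... | K , absorb = negligible (suc (2 * D)) K λ i → let n = size i in begin
      f i * suc (suc (2 * D)) ^ n                ≡⟨ cong (λ x → f i * x ^ n) (double D) ⟩
      f i * (2 * suc D) ^ n                      ≡⟨ cong (f i *_) (^-distribʳ-* 2 (suc D) n) ⟩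
      f i * (2 ^ n * suc D ^ n)                  ≡⟨ x∙yz≈y∙xz (f i) (2 ^ n) _ ⟩
      2 ^ n * (f i * suc D ^ n)                  ≤⟨ *-monoʳ-≤ (2 ^ n) (h i) ⟩
      2 ^ n * (n ^ suc k * E ^ n)                ≡⟨ x∙yz≈y∙xz (2 ^ n) (n ^ suc k) _ ⟩
      n ^ suc k * (2 ^ n * E ^ n)                ≡⟨ cong (n ^ suc k *_) (^-distribʳ-* 2 E n) ⟨
      n ^ suc k * (2 * E) ^ n                    ≤⟨ absorb n ⟩
      K * suc (2 * E) ^ n                        ≤⟨ *-monoʳ-≤ K (^-monoˡ-≤ n base) ⟩
      K * (3 + 4 * suc (2 * D)) ^ n              ∎
      where
      open ≤-Reasoning
      double : ∀ D → suc (suc (2 * D)) ≡ 2 * suc D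
      double = solve-∀
      octuple : ∀ D → 2 * (4 * suc D) ≡ suc (3 + 4 * suc (2 * D))
      octuple = solve-∀
      odd : ∀ E → 2 * suc E ≡ suc (suc (2 * E))
      odd = solve-∀
      base : suc (2 * E) ≤ 3 + 4 * suc (2 * D)
      base = s≤s⁻¹ (≤-trans (≤-reflexive (sym (odd E))) (≤-trans (*-monoʳ-≤ 2 E<4D) (≤-reflexive (octuple D))))

  -- Latin squares

  -- Give each set the weight u^|A| v^(n-|A|). Every set counted weighs at least D^n, and all sets
  -- together weigh (u + v)^n.
  tail-bound : ∀ {D u v} r s .{{_ : NonZero (r + s)}} → u ≤ v → D ^ (r + s) ≤ u ^ r * v ^ s → ∀ n →
               ∑ (subsets n) (λ A → 𝟙 ((r + s) * ∣ A ∣ ≤? r * n)) * D ^ n ≤ (u + v) ^ n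
  tail-bound {D} {u} {v} r s u≤v D≤ n = begin
    ∑ (subsets n) (λ A → 𝟙 ((r + s) * ∣ A ∣ ≤? r * n)) * D ^ n  ≡⟨ ∑-*ʳ (subsets n) (D ^ n) _ ⟨
    ∑ (subsets n) (λ A → 𝟙 ((r + s) * ∣ A ∣ ≤? r * n) * D ^ n)
      ≤⟨ ∑-mono (subsets n) (λ A → 𝟙-* ((r + s) * ∣ A ∣ ≤? r * n) λ h →
           D^n≤u^a*v^b r s u≤v D≤ h (∣A∣+∣∁A∣≡n A)) ⟩
    ∑ (subsets n) (λ A → u ^ ∣ A ∣ * v ^ ∣ ∁ A ∣)               ≡⟨ ∑-binomial n u v ⟩
    (u + v) ^ n                                                ∎
    where open ≤-Reasoning

  -- A quasigroup in equational form. With both divisions among the data, conjugates arise by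
  -- permuting operations, and every row and column map carries its inverse.
  record LatinSquare (n : ℕ) : Set where
    infixl 7 _∙_ _\\_ _//_
    field
      _∙_ _\\_ _//_ : Fin n → Fin n → Fin n
      ∙-\\ : ∀ x z → x ∙ (x \\ z) ≡ z
      \\-∙ : ∀ x y → x \\ (x ∙ y) ≡ y
      //-∙ : ∀ z y → (z // y) ∙ y ≡ z
      ∙-// : ∀ x y → (x ∙ y) // y ≡ x

  module _ (L : LatinSquare n) where
    open LatinSquare L

    transpose : LatinSquare n
    transpose = record
      { _∙_ = flip _∙_ ; _\\_ = flip _//_ ; _//_ = flip _\\_
      ; ∙-\\ = λ x z → //-∙ z x ; \\-∙ = λ x y → ∙-// y x
      ; //-∙ = λ z y → ∙-\\ y z ; ∙-// = λ x y → \\-∙ y x }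

    -- The roles of x and z in x ∙ y ≡ z are exchanged.
    conjugate : LatinSquare n
    conjugate = record
      { _∙_ = _//_ ; _\\_ = flip _\\_ ; _//_ = _∙_
      ; ∙-\\ = λ z x → trans (cong (_// (x \\ z)) (sym (∙-\\ x z))) (∙-// x (x \\ z))
      ; \\-∙ = λ z y → trans (cong ((z // y) \\_) (sym (//-∙ z y))) (\\-∙ (z // y) y)
      ; //-∙ = ∙-// ; ∙-// = //-∙ }

    Avoids : Subset n → Subset n → Subset n → Set
    Avoids A B C = ∀ x y → x ∈ˢ A → y ∈ˢ B → x ∙ y ∉ˢ C

    Bad : Subset n → Subset n → Subset n → Set
    Bad A B C = (Nonempty A × Nonempty B × Nonempty C) × Avoids A B C

    bad? : ∀ A B C → Dec (Bad A B C)
    bad? A B C = (nonempty? A ×-dec nonempty? B ×-dec nonempty? C) ×-dec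
      (Fin.all? λ x → Fin.all? λ y → (x ∈? A) →-dec ((y ∈? B) →-dec ¬? (x ∙ y ∈? C)))

    -- The set x ∙ B, as the preimage of `B` under left division by x.
    translate : Fin n → Subset n → Subset n
    translate x B = comprehension (λ z → x \\ z ∈? B)

    ∣translate∣ : ∀ x B → ∣ translate x B ∣ ≡ ∣ B ∣
    ∣translate∣ x B = begin
      ∣ translate x B ∣                                ≡⟨ ∣∣-∑ (translate x B) ⟩
      ∑ (points n) (λ z → 𝟙 (z ∈? translate x B))      ≡⟨ ∑-cong (points n) (𝟙-comprehension (λ z → x \\ z ∈? B)) ⟩
      ∑ (points n) (λ z → 𝟙 (x \\ z ∈? B))             ≡⟨ ∑-reindex (x \\_) (x ∙_) (\\-∙ x) (∙-\\ x) (λ y → 𝟙 (y ∈? B)) ⟩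
      ∑ (points n) (λ y → 𝟙 (y ∈? B))                  ≡⟨ ∣∣-∑ B ⟨
      ∣ B ∣                                            ∎
      where open ≡-Reasoning

    ∣∁translate∣ : ∀ x B → ∣ ∁ (translate x B) ∣ ≡ ∣ ∁ B ∣
    ∣∁translate∣ x B = trans (∣∁p∣≡n∸∣p∣ (translate x B))
      (trans (cong (n ∸_) (∣translate∣ x B)) (sym (∣∁p∣≡n∸∣p∣ B)))

    avoids⇒⊆∁translate : ∀ {A B C x} → Avoids A B C → x ∈ˢ A → C ⊆ ∁ (translate x B)
    avoids⇒⊆∁translate {B = B} {C} {x} av x∈A {z} z∈C = x∉p⇒x∈∁p λ z∈xB →
      av x (x \\ z) x∈A (∈-comprehension⁻ (λ z → x \\ z ∈? B) z∈xB) (subst (_∈ˢ C) (sym (∙-\\ x z)) z∈C)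

    fibre : Subset n → ℕ
    fibre A = ∑ (subsets n) λ B → ∑ (subsets n) λ C → 𝟙 (bad? A B C)

    -- A union bound over the point x of `A` costs the factor n. For fixed x and `B`, the set `C`
    -- lies in the complement of x ∙ B, which has n - |B| points, and the sum of 2^(n-|B|) over `B`
    -- is 3^n.
    fibre≤n*3^n : ∀ A → fibre A ≤ n * 3 ^ n
    fibre≤n*3^n A = begin
      fibre A
        ≤⟨ ∑-mono (subsets n) (λ B → ∑-mono (subsets n) λ C → 𝟙≤ (bad? A B C) (witness B C)) ⟩
      ∑ (subsets n) (λ B → ∑ (subsets n) λ C → ∑ (points n) λ x → 𝟙 (C ⊆? ∁ (translate x B)))
        ≡⟨ ∑-cong (subsets n) (λ B → trans (∑-swap (subsets n) (points n) _) (∑-cong (points n) λ x →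
             trans (∑-powerset₁ (∁ (translate x B))) (cong (2 ^_) (∣∁translate∣ x B)))) ⟩
      ∑ (subsets n) (λ B → ∑ (points n) λ x → 2 ^ ∣ ∁ B ∣)
        ≡⟨ ∑-cong (subsets n) (λ B → ∑-points-const n (2 ^ ∣ ∁ B ∣)) ⟩
      ∑ (subsets n) (λ B → n * 2 ^ ∣ ∁ B ∣)
        ≡⟨ ∑-*ˡ (subsets n) n _ ⟩
      n * ∑ (subsets n) (λ B → 2 ^ ∣ ∁ B ∣)
        ≡⟨ cong (n *_) (∑-cong (subsets n) λ B → sym (trans (cong (_* 2 ^ ∣ ∁ B ∣) (^-zeroˡ ∣ B ∣)) (*-identityˡ _))) ⟩
      n * ∑ (subsets n) (λ B → 1 ^ ∣ B ∣ * 2 ^ ∣ ∁ B ∣)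
        ≡⟨ cong (n *_) (∑-binomial n 1 2) ⟩
      n * 3 ^ n ∎
      where
      open ≤-Reasoning
      witness : ∀ B C → Bad A B C → 1 ≤ ∑ (points n) λ x → 𝟙 (C ⊆? ∁ (translate x B))
      witness B C (((x , x∈A) , _) , av) =
        ≤-trans (≤-reflexive (sym (𝟙-true (C ⊆? ∁ (translate x B)) (avoids⇒⊆∁translate av x∈A))))
                (term≤∑ (λ x → 𝟙 (C ⊆? ∁ (translate x B))) (∈-allFin x))

    -- Covers by translates of A, and fingerprints

    module _ (A : Subset n) where
      -- The union of the sets A ∙ y over the entries y of the tuple.
      cover : Vec (Fin n) k → Subset n
      cover []      = ⊥
      cover (y ∷ S) = comprehension (λ z → z // y ∈? A) ∪ cover S

      -- The numbers of points of A ∙ y outside and inside `Q`, counted through their preimages in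
      -- `A`.
      deficit hits : Subset n → Fin n → ℕ
      deficit Q y = ∑ (points n) λ x → 𝟙 (x ∈? A) * 𝟙 (x ∙ y ∈? ∁ Q)
      hits    Q y = ∑ (points n) λ x → 𝟙 (x ∈? A) * 𝟙 (x ∙ y ∈? Q)

      𝟙-∁ : ∀ (Q : Subset n) z → 𝟙 (z ∈? ∁ Q) + 𝟙 (z ∈? Q) ≡ 1
      𝟙-∁ Q z with z ∈? Q
      ... | yes z∈Q = cong (_+ 1) (𝟙-cong (z ∈? ∁ Q) (no id) (λ z∈∁Q → x∈∁p⇒x∉p z∈∁Q z∈Q) λ ())
      ... | no  z∉Q = cong (_+ 0) (𝟙-true (z ∈? ∁ Q) (x∉p⇒x∈∁p z∉Q))

      deficit+hits : ∀ Q y → deficit Q y + hits Q y ≡ ∣ A ∣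
      deficit+hits Q y = begin
        deficit Q y + hits Q y                   ≡⟨ ∑-+ (points n) _ _ ⟨
        ∑ (points n) (λ x → 𝟙 (x ∈? A) * 𝟙 (x ∙ y ∈? ∁ Q) + 𝟙 (x ∈? A) * 𝟙 (x ∙ y ∈? Q))
          ≡⟨ ∑-cong (points n) (λ x → trans (sym (*-distribˡ-+ (𝟙 (x ∈? A)) _ _))
               (trans (cong (𝟙 (x ∈? A) *_) (𝟙-∁ Q (x ∙ y))) (*-identityʳ _))) ⟩
        ∑ (points n) (λ x → 𝟙 (x ∈? A))         ≡⟨ ∣∣-∑ A ⟨
        ∣ A ∣                                   ∎
        where open ≡-Reasoning

      -- The substitution z = x ∙ y turns the deficit into the number of points of A ∙ y outside the
      -- old cover, which are precisely the points that y adds.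
      ∣cover∣+deficit≤ : ∀ y (S : Vec (Fin n) k) → ∣ cover S ∣ + deficit (cover S) y ≤ ∣ cover (y ∷ S) ∣
      ∣cover∣+deficit≤ y S = begin
        ∣ Q ∣ + deficit Q y
          ≡⟨ cong₂ _+_ (∣∣-∑ Q) (∑-cong (points n) λ x → cong (λ w → 𝟙 (w ∈? A) * 𝟙 (x ∙ y ∈? ∁ Q)) (sym (∙-// x y))) ⟩
        ∑ (points n) (λ z → 𝟙 (z ∈? Q)) + ∑ (points n) (λ x → new (x ∙ y))
          ≡⟨ cong (∑ (points n) (λ z → 𝟙 (z ∈? Q)) +_) (∑-reindex (_∙ y) (_// y) (λ z → //-∙ z y) (λ x → ∙-// x y) new) ⟩
        ∑ (points n) (λ z → 𝟙 (z ∈? Q)) + ∑ (points n) new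
          ≡⟨ ∑-+ (points n) _ new ⟨
        ∑ (points n) (λ z → 𝟙 (z ∈? Q) + new z)
          ≤⟨ ∑-mono (points n) pointwise ⟩
        ∑ (points n) (λ z → 𝟙 (z ∈? cover (y ∷ S)))   ≡⟨ ∣∣-∑ (cover (y ∷ S)) ⟨
        ∣ cover (y ∷ S) ∣ ∎
        where
        open ≤-Reasoning
        Q : Subset n
        Q = cover S
        new : Fin n → ℕ
        new z = 𝟙 (z // y ∈? A) * 𝟙 (z ∈? ∁ Q)
        pointwise : ∀ z → 𝟙 (z ∈? Q) + new z ≤ 𝟙 (z ∈? cover (y ∷ S))
        pointwise z with z ∈? Q
        ... | yes z∈Q = begin
          1 + 𝟙 (z // y ∈? A) * 𝟙 (z ∈? ∁ Q)
            ≡⟨ cong (λ w → 1 + 𝟙 (z // y ∈? A) * w) (𝟙-cong (z ∈? ∁ Q) (no id) (λ z∈∁Q → x∈∁p⇒x∉p z∈∁Q z∈Q) λ ()) ⟩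
          1 + 𝟙 (z // y ∈? A) * 0       ≡⟨ cong suc (*-zeroʳ (𝟙 (z // y ∈? A))) ⟩
          1                             ≡⟨ 𝟙-true (z ∈? cover (y ∷ S)) (q⊆p∪q _ Q z∈Q) ⟨
          𝟙 (z ∈? cover (y ∷ S))        ∎
        ... | no z∉Q = 𝟙-* (z // y ∈? A) λ z//y∈A → 𝟙≤ (z ∈? ∁ Q) λ _ →
          ≤-reflexive (sym (𝟙-true (z ∈? cover (y ∷ S)) (p⊆p∪q Q (∈-comprehension⁺ (λ z → z // y ∈? A) z//y∈A))))

      deficit-antitone : ∀ {Q Q′} y → Q ⊆ Q′ → deficit Q′ y ≤ deficit Q y
      deficit-antitone {Q} {Q′} y Q⊆Q′ = ∑-mono (points n) λ x → *-monoʳ-≤ (𝟙 (x ∈? A))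
        (𝟙≤ (x ∙ y ∈? ∁ Q′) λ h → ≤-reflexive (sym (𝟙-true (x ∙ y ∈? ∁ Q) (p⊆q⇒∁p⊇∁q Q⊆Q′ h))))

      -- The container for `B`: the points y for which `Q` misses at most m points of A ∙ y.
      reach : ℕ → Subset n → Subset n
      reach m Q = comprehension (λ y → deficit Q y ≤? m)

      -- Double counting of the pairs (x , y) with x in `A`, y in the reach and x ∙ y in `Q`: each y
      -- occurs in at least |A| - m of them, and each x in at most |Q|, since y ↦ x ∙ y is a
      -- bijection.
      ∣reach∣*∣A∣≤ : ∀ m Q → ∣ reach m Q ∣ * ∣ A ∣ ≤ ∣ A ∣ * ∣ Q ∣ + m * ∣ reach m Q ∣
      ∣reach∣*∣A∣≤ m Q = begin
        ∣ R ∣ * ∣ A ∣                                            ≡⟨ cong (_* ∣ A ∣) (∣∣-∑ R) ⟩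
        ∑ (points n) (λ y → 𝟙 (y ∈? R)) * ∣ A ∣                  ≡⟨ ∑-*ʳ (points n) ∣ A ∣ _ ⟨
        ∑ (points n) (λ y → 𝟙 (y ∈? R) * ∣ A ∣)                  ≤⟨ ∑-mono (points n) pointwise ⟩
        ∑ (points n) (λ y → hits Q y + m * 𝟙 (y ∈? R))           ≡⟨ ∑-+ (points n) _ _ ⟩
        ∑ (points n) (hits Q) + ∑ (points n) (λ y → m * 𝟙 (y ∈? R))
          ≡⟨ cong₂ _+_ (∑-swap (points n) (points n) _)
               (trans (∑-*ˡ (points n) m _) (cong (m *_) (sym (∣∣-∑ R)))) ⟩
        ∑ (points n) (λ x → ∑ (points n) λ y → 𝟙 (x ∈? A) * 𝟙 (x ∙ y ∈? Q)) + m * ∣ R ∣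
          ≡⟨ cong (_+ m * ∣ R ∣) (∑-cong (points n) λ x → trans (∑-*ˡ (points n) (𝟙 (x ∈? A)) _) (cong (𝟙 (x ∈? A) *_)
               (trans (∑-reindex (x ∙_) (x \\_) (∙-\\ x) (\\-∙ x) (λ z → 𝟙 (z ∈? Q))) (sym (∣∣-∑ Q))))) ⟩
        ∑ (points n) (λ x → 𝟙 (x ∈? A) * ∣ Q ∣) + m * ∣ R ∣
          ≡⟨ cong (_+ m * ∣ R ∣) (trans (∑-*ʳ (points n) ∣ Q ∣ _) (cong (_* ∣ Q ∣) (sym (∣∣-∑ A)))) ⟩
        ∣ A ∣ * ∣ Q ∣ + m * ∣ R ∣                                ∎
        where
        open ≤-Reasoning
        R : Subset n
        R = reach m Q
        pointwise : ∀ y → 𝟙 (y ∈? R) * ∣ A ∣ ≤ hits Q y + m * 𝟙 (y ∈? R)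
        pointwise y = begin
          𝟙 (y ∈? R) * ∣ A ∣               ≤⟨ 𝟙-*-mono (y ∈? R) (λ y∈R → begin
            ∣ A ∣                          ≡⟨ deficit+hits Q y ⟨
            deficit Q y + hits Q y         ≤⟨ +-monoˡ-≤ (hits Q y) (∈-comprehension⁻ (λ y → deficit Q y ≤? m) y∈R) ⟩
            m + hits Q y                   ∎) ⟩
          𝟙 (y ∈? R) * (m + hits Q y)      ≡⟨ *-distribˡ-+ (𝟙 (y ∈? R)) m _ ⟩
          𝟙 (y ∈? R) * m + 𝟙 (y ∈? R) * hits Q y
            ≤⟨ +-monoʳ-≤ _ (𝟙-* (y ∈? R) λ _ → ≤-refl) ⟩
          𝟙 (y ∈? R) * m + hits Q y        ≡⟨ +-comm _ (hits Q y) ⟩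
          hits Q y + 𝟙 (y ∈? R) * m        ≡⟨ cong (hits Q y +_) (*-comm (𝟙 (y ∈? R)) m) ⟩
          hits Q y + m * 𝟙 (y ∈? R)        ∎

      avoids⇒⊆∁cover : ∀ {B C} → Avoids A B C → {S : Vec (Fin n) k} → All (_∈ˢ B) S → C ⊆ ∁ (cover S)
      avoids⇒⊆∁cover {B = B} {C} av {S} S⊆B {z} z∈C = x∉p⇒x∈∁p (go S⊆B)
        where
        go : ∀ {k} {S : Vec (Fin n) k} → All (_∈ˢ B) S → z ∉ˢ cover S
        go []                     z∈ = ∉⊥ z∈
        go (_∷_ {x = y} {xs = S} y∈B S⊆B) z∈ with x∈p∪q⁻ _ (cover S) z∈
        ... | inj₁ z∈A∙y = av (z // y) y (∈-comprehension⁻ (λ z → z // y ∈? A) z∈A∙y) y∈B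
                             (subst (_∈ˢ C) (sym (//-∙ z y)) z∈C)
        ... | inj₂ z∈Q   = go S⊆B z∈Q

      -- Each tuple entry adds more than m points to the cover, for as long as some y ∈ B does so.
      fingerprint : ∀ m {B} → Nonempty B → ∀ k → Σ[ S ∈ Vec (Fin n) k ]
                    All (_∈ˢ B) S × (B ⊆ reach m (cover S) ⊎ k * suc m ≤ ∣ cover S ∣)
      fingerprint m         B≠∅         zero    = [] , [] , inj₂ z≤n
      fingerprint m {B = B} B≠∅@(y₀ , y₀∈B) (suc k) with fingerprint m B≠∅ k
      -- Here `y₀` merely pads the tuple to the prescribed length: a larger cover has smaller
      -- deficits, so `B` stays within reach.
      ... | S , S⊆B , inj₁ B⊆R = y₀ ∷ S , y₀∈B ∷ S⊆B , inj₁ λ {y} y∈B →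
        ∈-comprehension⁺ (λ y → deficit (cover (y₀ ∷ S)) y ≤? m)
          (≤-trans (deficit-antitone y (q⊆p∪q _ (cover S))) (∈-comprehension⁻ (λ y → deficit (cover S) y ≤? m) (B⊆R y∈B)))
      ... | S , S⊆B , inj₂ large with Fin.any? (λ y → (y ∈? B) ×-dec (suc m ≤? deficit (cover S) y))
      ...   | yes (y , y∈B , m<d) = y ∷ S , y∈B ∷ S⊆B , inj₂ (begin
        suc m + k * suc m                     ≡⟨ +-comm (suc m) _ ⟩
        k * suc m + suc m                     ≤⟨ +-mono-≤ large m<d ⟩
        ∣ cover S ∣ + deficit (cover S) y     ≤⟨ ∣cover∣+deficit≤ y S ⟩
        ∣ cover (y ∷ S) ∣                     ∎)
        where open ≤-Reasoning
      -- No point of `B` has deficit above m, so the current cover already has `B` within reach, and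
      -- `y₀` is again padding.
      ...   | no ¬∃ = y₀ ∷ S , y₀∈B ∷ S⊆B , inj₁ λ {y} y∈B →
        ∈-comprehension⁺ (λ y → deficit (cover (y₀ ∷ S)) y ≤? m)
          (≤-trans (deficit-antitone y (q⊆p∪q _ (cover S))) (≮⇒≥ λ m<d → ¬∃ (y , y∈B , m<d)))

  -- Containers

  module _ (L : LatinSquare n) (A : Subset n) (l M : ℕ) .{{_ : NonZero l}} .{{_ : NonZero M}} (n≤l∣A∣ : n ≤ l * ∣ A ∣) where

    private
      -- A translate is worth adding while more than a fraction 1/M of it is new. As |A| ≥ n/l, a
      -- tuple of M · l such additions would cover more than n points.
      m degree : ℕ
      m = ∣ A ∣ / M
      degree = M * l

      Q R : Vec (Fin n) k → Subset n
      Q S = cover L A S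
      R S = reach L A m (Q S)

    n<degree*[1+m] : n < degree * suc m
    n<degree*[1+m] = begin-strict
      n                      ≤⟨ n≤l∣A∣ ⟩
      l * ∣ A ∣              <⟨ *-monoʳ-< l ∣A∣<[1+m]*M ⟩
      l * (suc m * M)        ≡⟨ rearrange l (suc m) M ⟩
      degree * suc m         ∎
      where
      open ≤-Reasoning
      ∣A∣<[1+m]*M : ∣ A ∣ < suc m * M
      ∣A∣<[1+m]*M = begin-strict
        ∣ A ∣                  ≡⟨ m≡m%n+[m/n]*n ∣ A ∣ M ⟩
        ∣ A ∣ % M + m * M      <⟨ +-monoˡ-< (m * M) (m%n<n ∣ A ∣ M) ⟩
        suc m * M              ∎
      rearrange : ∀ x y z → x * (y * z) ≡ z * x * y
      rearrange = solve-∀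

    -- Dividing the double count by |A| and using m ≤ |A|/M gives |R| ≤ |Q| + |R|/M, where |R| ≤ n.
    -- If `A` is empty, then n ≤ l|A| forces n = 0.
    M∣R∣≤M∣Q∣+n : ∀ (S : Vec (Fin n) k) → M * ∣ R S ∣ ≤ M * ∣ Q S ∣ + n
    M∣R∣≤M∣Q∣+n S with ∣ A ∣ ≟ 0
    ... | yes a≡0 = begin
      M * ∣ R S ∣             ≤⟨ *-monoʳ-≤ M (≤-trans (∣p∣≤n (R S)) n≤l∣A∣) ⟩
      M * (l * ∣ A ∣)         ≡⟨ cong (λ a → M * (l * a)) a≡0 ⟩
      M * (l * 0)             ≡⟨ trans (cong (M *_) (*-zeroʳ l)) (*-zeroʳ M) ⟩
      0                       ≤⟨ z≤n ⟩
      M * ∣ Q S ∣ + n         ∎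
      where open ≤-Reasoning
    ... | no a≢0 = *-cancelˡ-≤ a {{≢-nonZero a≢0}} (begin
      a * (M * ∣ R S ∣)                        ≡⟨ trans (x∙yz≈y∙xz a M _) (cong (M *_) (*-comm a _)) ⟩
      M * (∣ R S ∣ * a)                        ≤⟨ *-monoʳ-≤ M (∣reach∣*∣A∣≤ L A m (Q S)) ⟩
      M * (a * ∣ Q S ∣ + m * ∣ R S ∣)          ≡⟨ rearrange M a (∣ Q S ∣) m (∣ R S ∣) ⟩
      a * (M * ∣ Q S ∣) + m * M * ∣ R S ∣      ≤⟨ +-monoʳ-≤ _ (*-mono-≤ (m/n*n≤m a M) (∣p∣≤n (R S))) ⟩
      a * (M * ∣ Q S ∣) + a * n                ≡⟨ *-distribˡ-+ a _ n ⟨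
      a * (M * ∣ Q S ∣ + n)                    ∎)
      where
      open ≤-Reasoning
      a : ℕ
      a = ∣ A ∣
      rearrange : ∀ M a q m r → M * (a * q + m * r) ≡ a * (M * q) + m * M * r
      rearrange = solve-∀

    -- The containers for `B` and `C` have at most n + e points together, where e is the excess of
    -- |R| over |Q|, truncated at 0. As Me ≤ n, the factor 2^e is at most (1 + 1/M)^n.
    container-size : ∀ (S : Vec (Fin n) k) → 2 ^ ∣ R S ∣ * 2 ^ ∣ ∁ (Q S) ∣ * M ^ n ≤ (2 * suc M) ^ n
    container-size S = begin
      2 ^ ∣ R S ∣ * 2 ^ ∣ ∁ (Q S) ∣ * M ^ n     ≡⟨ cong (_* M ^ n) (^-distribˡ-+-* 2 ∣ R S ∣ _) ⟨
      2 ^ (∣ R S ∣ + ∣ ∁ (Q S) ∣) * M ^ n       ≤⟨ *-monoˡ-≤ (M ^ n) (^-monoʳ-≤ 2 sizes) ⟩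
      2 ^ (n + e) * M ^ n                       ≡⟨ cong (_* M ^ n) (^-distribˡ-+-* 2 n e) ⟩
      2 ^ n * 2 ^ e * M ^ n                     ≡⟨ *-assoc (2 ^ n) _ _ ⟩
      2 ^ n * (2 ^ e * M ^ n)                   ≤⟨ *-monoʳ-≤ (2 ^ n) (2^e*m^n≤[1+m]^n M Me≤n) ⟩
      2 ^ n * suc M ^ n                         ≡⟨ ^-distribʳ-* 2 (suc M) n ⟨
      (2 * suc M) ^ n                           ∎
      where
      open ≤-Reasoning
      e : ℕ
      e = ∣ R S ∣ ∸ ∣ Q S ∣
      Me≤n : M * e ≤ n
      Me≤n = ≤-trans (≤-reflexive (*-distribˡ-∸ M ∣ R S ∣ ∣ Q S ∣)) (m≤n+o⇒m∸n≤o (M * ∣ R S ∣) (M * ∣ Q S ∣) (M∣R∣≤M∣Q∣+n S))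
      sizes : ∣ R S ∣ + ∣ ∁ (Q S) ∣ ≤ n + e
      sizes = begin
        ∣ R S ∣ + ∣ ∁ (Q S) ∣                   ≤⟨ +-monoˡ-≤ _ (m≤n+m∸n ∣ R S ∣ ∣ Q S ∣) ⟩
        ∣ Q S ∣ + e + ∣ ∁ (Q S) ∣               ≡⟨ swap-last ∣ Q S ∣ e _ ⟩
        ∣ Q S ∣ + ∣ ∁ (Q S) ∣ + e               ≡⟨ cong (_+ e) (∣A∣+∣∁A∣≡n (Q S)) ⟩
        n + e                                   ∎
        where
        swap-last : ∀ x y z → x + y + z ≡ x + z + y
        swap-last = solve-∀

    -- Each bad pair (B , C) has a fingerprint S with `B` inside `R S` and `C` inside the complement
    -- of `Q S`. These containers depend only on `A` and S, so the pairs are counted tuple by tuple,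
    -- over n^degree tuples.
    fibre*M^n≤ : fibre L A * M ^ n ≤ n ^ degree * (2 * suc M) ^ n
    fibre*M^n≤ = begin
      fibre L A * M ^ n
        ≤⟨ *-monoˡ-≤ (M ^ n) (∑-mono (subsets n) λ B → ∑-mono (subsets n) λ C → 𝟙≤ (bad? L A B C) witness) ⟩
      ∑ (subsets n) (λ B → ∑ (subsets n) λ C → ∑ (tuples n degree) λ S → 𝟙 (B ⊆? R S) * 𝟙 (C ⊆? ∁ (Q S))) * M ^ n
        ≡⟨ cong (_* M ^ n) (trans (∑-cong (subsets n) λ B → ∑-swap (subsets n) (tuples n degree) _)
             (∑-swap (subsets n) (tuples n degree) _)) ⟩
      ∑ (tuples n degree) (λ S → ∑ (subsets n) λ B → ∑ (subsets n) λ C → 𝟙 (B ⊆? R S) * 𝟙 (C ⊆? ∁ (Q S))) * M ^ n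
        ≡⟨ ∑-*ʳ (tuples n degree) (M ^ n) _ ⟨
      ∑ (tuples n degree) (λ S → (∑ (subsets n) λ B → ∑ (subsets n) λ C → 𝟙 (B ⊆? R S) * 𝟙 (C ⊆? ∁ (Q S))) * M ^ n)
        ≡⟨ ∑-cong (tuples n degree) (λ S → cong (_* M ^ n) (trans (∑-∑-product (subsets n) (subsets n) _ _)
             (cong₂ _*_ (∑-powerset₁ (R S)) (∑-powerset₁ (∁ (Q S)))))) ⟩
      ∑ (tuples n degree) (λ S → 2 ^ ∣ R S ∣ * 2 ^ ∣ ∁ (Q S) ∣ * M ^ n)
        ≤⟨ ∑-mono (tuples n degree) container-size ⟩
      ∑ (tuples n degree) (λ S → (2 * suc M) ^ n)
        ≡⟨ ∑-tuples-const n degree _ ⟩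
      n ^ degree * (2 * suc M) ^ n ∎
      where
      open ≤-Reasoning
      witness : ∀ {B C} → Bad L A B C → 1 ≤ ∑ (tuples n degree) λ S → 𝟙 (B ⊆? R S) * 𝟙 (C ⊆? ∁ (Q S))
      witness {B} {C} ((_ , B≠∅ , _) , av) with fingerprint L A m B≠∅ degree
      ... | S , S⊆B , inj₁ B⊆R = begin
        1                                    ≡⟨ cong₂ _*_ (𝟙-true (B ⊆? R S) B⊆R) (𝟙-true (C ⊆? ∁ (Q S)) (avoids⇒⊆∁cover L A av S⊆B)) ⟨
        𝟙 (B ⊆? R S) * 𝟙 (C ⊆? ∁ (Q S))      ≤⟨ term≤∑ _ (tuples-complete S) ⟩
        ∑ (tuples n degree) (λ S → 𝟙 (B ⊆? R S) * 𝟙 (C ⊆? ∁ (Q S))) ∎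
      -- After `degree` additions of more than m points each, the cover would exceed the n available
      -- points.
      ... | S , _ , inj₂ large = contradiction (≤-trans n<degree*[1+m] (≤-trans large (∣p∣≤n (Q S)))) (n≮n n)

  -- Triples of nonempty sets

  bad-transpose : ∀ (L : LatinSquare n) {A B C} → Bad L A B C → Bad (transpose L) B A C
  bad-transpose L ((a , b , c) , av) = (b , a , c) , λ y x y∈B x∈A → av x y x∈A y∈B

  avoids-conjugate : ∀ (L : LatinSquare n) {A B C} → Avoids L A B C → Avoids (conjugate L) C B A
  avoids-conjugate L {C = C} av z y z∈C y∈B z//y∈A = av (z // y) y z//y∈A y∈B (subst (_∈ˢ C) (sym (//-∙ z y)) z∈C)
    where open LatinSquare L

  bad-conjugate : ∀ (L : LatinSquare n) {A B C} → Bad L A B C → Bad (conjugate L) C B A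
  bad-conjugate L ((a , b , c) , av) = (c , b , a) , avoids-conjugate L av

  -- The ranges overlap at the thresholds n/16 and 3n/7, which is harmless for upper bounds. The
  -- factor in `1 * n` fits the form of `tail-bound`, and `dense` sums over `B` first because `B`
  -- confines the other two sets.
  small sparse middle dense total : ∃ LatinSquare → ℕ
  small  (n , L) = ∑ (subsets n) λ A → 𝟙 (7 * ∣ A ∣ ≤? 3 * n) * fibre L A
  sparse (n , L) = ∑ (subsets n) λ A → 𝟙 (16 * ∣ A ∣ ≤? 1 * n) * fibre L A
  middle (n , L) = ∑ (subsets n) λ A → 𝟙 (7 * ∣ A ∣ ≤? 3 * n) * (𝟙 (n ≤? 16 * ∣ A ∣) * fibre L A)
  dense  (n , L) = ∑ (subsets n) λ B → ∑ (subsets n) λ A → ∑ (subsets n) λ C →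
    𝟙 (3 * n ≤? 7 * ∣ A ∣) * (𝟙 (3 * n ≤? 7 * ∣ B ∣) * (𝟙 (3 * n ≤? 7 * ∣ C ∣) * 𝟙 (bad? L A B C)))
  total  (n , L) = ∑ (subsets n) (fibre L)

  -- With weights 1 and 16, the inequality 13^16 ≤ 16^15 leaves at most (17/13)^n sets `A`. Each has
  -- a fibre of at most n · 3^n, for a rate 51/13 < 4.
  sparse*13^n≤ : (L : LatinSquare n) → sparse (n , L) * 13 ^ n ≤ n ^ 1 * 51 ^ n
  sparse*13^n≤ {n} L = begin
    sparse (n , L) * 13 ^ n
      ≤⟨ *-monoˡ-≤ (13 ^ n) (∑-mono (subsets n) λ A → *-monoʳ-≤ (𝟙 (16 * ∣ A ∣ ≤? 1 * n)) (fibre≤n*3^n L A)) ⟩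
    ∑ (subsets n) (λ A → 𝟙 (16 * ∣ A ∣ ≤? 1 * n) * (n * 3 ^ n)) * 13 ^ n
      ≡⟨ cong (_* 13 ^ n) (∑-*ʳ (subsets n) (n * 3 ^ n) _) ⟩
    tail * (n * 3 ^ n) * 13 ^ n       ≡⟨ rearrange tail n (3 ^ n) (13 ^ n) ⟩
    n * 1 * (3 ^ n * (tail * 13 ^ n)) ≤⟨ *-monoʳ-≤ (n * 1) (*-monoʳ-≤ (3 ^ n) (tail-bound 1 15 (s≤s z≤n) (≤ᵇ⇒≤ (13 ^ 16) (16 ^ 15 + 0) _) n)) ⟩
    n * 1 * (3 ^ n * 17 ^ n)          ≡⟨ cong (n * 1 *_) (^-distribʳ-* 3 17 n) ⟨
    n * 1 * 51 ^ n                    ∎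
    where
    open ≤-Reasoning
    tail : ℕ
    tail = ∑ (subsets n) (λ A → 𝟙 (16 * ∣ A ∣ ≤? 1 * n))
    rearrange : ∀ t n x y → t * (n * x) * y ≡ n * 1 * (x * (t * y))
    rearrange = solve-∀

  -- The weights 45 : 60 = 3 : 4 are the optimal tilt for density 3/7. The tail bound for `A` is
  -- multiplied by the container bound for its fibre with l = 16.
  middle*[53M]^n≤ : (L : LatinSquare n) (M : ℕ) .{{_ : NonZero M}} →
                    middle (n , L) * (53 * M) ^ n ≤ n ^ (M * 16) * (105 * (2 * suc M)) ^ n
  middle*[53M]^n≤ {n} L M = begin
    middle (n , L) * (53 * M) ^ n
      ≡⟨ trans (cong (middle (n , L) *_) (trans (^-distribʳ-* 53 M n) (*-comm (53 ^ n) (M ^ n)))) (sym (*-assoc (middle (n , L)) (M ^ n) (53 ^ n))) ⟩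
    middle (n , L) * M ^ n * 53 ^ n
      ≡⟨ cong (_* 53 ^ n) (∑-*ʳ (subsets n) (M ^ n) _) ⟨
    ∑ (subsets n) (λ A → 𝟙 (7 * ∣ A ∣ ≤? 3 * n) * (𝟙 (n ≤? 16 * ∣ A ∣) * fibre L A) * M ^ n) * 53 ^ n
      ≤⟨ *-monoˡ-≤ (53 ^ n) (∑-mono (subsets n) pointwise) ⟩
    ∑ (subsets n) (λ A → 𝟙 (7 * ∣ A ∣ ≤? 3 * n) * bound) * 53 ^ n
      ≡⟨ cong (_* 53 ^ n) (∑-*ʳ (subsets n) bound _) ⟩
    tail * bound * 53 ^ n                       ≡⟨ xy∙z≈xz∙y tail bound (53 ^ n) ⟩
    tail * 53 ^ n * bound                       ≤⟨ *-monoˡ-≤ bound (tail-bound 3 4 (≤ᵇ⇒≤ 45 60 _) (≤ᵇ⇒≤ (53 ^ 7) (45 ^ 3 * 60 ^ 4) _) n) ⟩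
    105 ^ n * bound                             ≡⟨ x∙yz≈y∙xz (105 ^ n) (n ^ (M * 16)) _ ⟩
    n ^ (M * 16) * (105 ^ n * (2 * suc M) ^ n)  ≡⟨ cong (n ^ (M * 16) *_) (^-distribʳ-* 105 (2 * suc M) n) ⟨
    n ^ (M * 16) * (105 * (2 * suc M)) ^ n      ∎
    where
    open ≤-Reasoning
    tail bound : ℕ
    tail  = ∑ (subsets n) (λ A → 𝟙 (7 * ∣ A ∣ ≤? 3 * n))
    bound = n ^ (M * 16) * (2 * suc M) ^ n
    pointwise : ∀ A → 𝟙 (7 * ∣ A ∣ ≤? 3 * n) * (𝟙 (n ≤? 16 * ∣ A ∣) * fibre L A) * M ^ n ≤ 𝟙 (7 * ∣ A ∣ ≤? 3 * n) * bound
    pointwise A = begin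
      𝟙 (7 * ∣ A ∣ ≤? 3 * n) * (𝟙 (n ≤? 16 * ∣ A ∣) * fibre L A) * M ^ n
        ≡⟨ trans (*-assoc (𝟙 (7 * ∣ A ∣ ≤? 3 * n)) _ _) (cong (𝟙 (7 * ∣ A ∣ ≤? 3 * n) *_) (*-assoc (𝟙 (n ≤? 16 * ∣ A ∣)) _ _)) ⟩
      𝟙 (7 * ∣ A ∣ ≤? 3 * n) * (𝟙 (n ≤? 16 * ∣ A ∣) * (fibre L A * M ^ n))
        ≤⟨ *-monoʳ-≤ (𝟙 (7 * ∣ A ∣ ≤? 3 * n)) (𝟙-* (n ≤? 16 * ∣ A ∣) λ h → fibre*M^n≤ L A 16 M h) ⟩
      𝟙 (7 * ∣ A ∣ ≤? 3 * n) * bound ∎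

  -- A translate of `B` has a complement of n - |B| points, whose subsets, weighted by 3 per point,
  -- sum to 4^(n-|B|). The factor n counts the choices of x.
  ∑-translates : (L : LatinSquare n) (B : Subset n) →
                 ∑ (subsets n) (λ C → ∑ (points n) λ x → 𝟙 (C ⊆? ∁ (translate L x B)) * 3 ^ ∣ C ∣) ≡ n * 4 ^ ∣ ∁ B ∣
  ∑-translates {n} L B = begin
    ∑ (subsets n) (λ C → ∑ (points n) λ x → 𝟙 (C ⊆? ∁ (translate L x B)) * 3 ^ ∣ C ∣)
      ≡⟨ ∑-swap (subsets n) (points n) _ ⟩
    ∑ (points n) (λ x → ∑ (subsets n) λ C → 𝟙 (C ⊆? ∁ (translate L x B)) * 3 ^ ∣ C ∣)
      ≡⟨ ∑-cong (points n) (λ x → trans (∑-powerset (∁ (translate L x B)) 3) (cong (4 ^_) (∣∁translate∣ L x B))) ⟩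
    ∑ (points n) (λ x → 4 ^ ∣ ∁ B ∣)
      ≡⟨ ∑-points-const n _ ⟩
    n * 4 ^ ∣ ∁ B ∣ ∎
    where open ≡-Reasoning

  -- The seventh power of the inequality reduces to 33⁷ ≤ 4⁷ · (16 · 3 · 3)³.
  33^n≤ : ∀ n a b c → 3 * n ≤ 7 * a → 3 * n ≤ 7 * b → 3 * n ≤ 7 * c → 33 ^ n ≤ 4 ^ n * 16 ^ b * (3 ^ a * 3 ^ c)
  33^n≤ n a b c ha hb hc = ^-cancelˡ-≤ 7 (begin
    (33 ^ n) ^ 7                                            ≡⟨ ^-exchange 33 n 7 ⟩
    (33 ^ 7) ^ n                                            ≤⟨ ^-monoˡ-≤ n (≤ᵇ⇒≤ (33 ^ 7) (4 ^ 7 * 16 ^ 3 * (3 ^ 3 * 3 ^ 3)) _) ⟩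
    (4 ^ 7 * 16 ^ 3 * (3 ^ 3 * 3 ^ 3)) ^ n                  ≡⟨ product (4 ^ 7) (16 ^ 3) (3 ^ 3) (3 ^ 3) n ⟩
    (4 ^ 7) ^ n * (16 ^ 3) ^ n * ((3 ^ 3) ^ n * (3 ^ 3) ^ n)
      ≤⟨ *-mono-≤ (*-mono-≤ (≤-reflexive (^-exchange 4 7 n)) (raise 16 b hb)) (*-mono-≤ (raise 3 a ha) (raise 3 c hc)) ⟩
    (4 ^ n) ^ 7 * (16 ^ b) ^ 7 * ((3 ^ a) ^ 7 * (3 ^ c) ^ 7) ≡⟨ product (4 ^ n) (16 ^ b) (3 ^ a) (3 ^ c) 7 ⟨
    (4 ^ n * 16 ^ b * (3 ^ a * 3 ^ c)) ^ 7                  ∎)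
    where
    open ≤-Reasoning
    product : ∀ w x y z k → (w * x * (y * z)) ^ k ≡ w ^ k * x ^ k * (y ^ k * z ^ k)
    product w x y z k = trans (^-distribʳ-* (w * x) (y * z) k) (cong₂ _*_ (^-distribʳ-* w x k) (^-distribʳ-* y z k))
    raise : ∀ x .{{_ : NonZero x}} e → 3 * n ≤ 7 * e → (x ^ 3) ^ n ≤ (x ^ e) ^ 7
    raise x e h = begin
      (x ^ 3) ^ n     ≡⟨ ^-*-assoc x 3 n ⟩
      x ^ (3 * n)     ≤⟨ ^-monoʳ-≤ x h ⟩
      x ^ (7 * e)     ≡⟨ cong (x ^_) (*-comm 7 e) ⟩
      x ^ (e * 7)     ≡⟨ ^-*-assoc x e 7 ⟨
      (x ^ e) ^ 7     ∎

  -- Weights 3 on points of `A` and `C` and 16 on points of `B` make every `B` contribute the same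
  -- amount, n² · 4^n · 16^n, for a rate 128/33 < 4. The factor 4^n refines the integer rounding:
  -- the largest integer below (16 · 3 · 3)^(3/7) is 8, and 32/8 would not be below 4.
  dense*33^n≤ : (L : LatinSquare n) → dense (n , L) * 33 ^ n ≤ n ^ 2 * 128 ^ n
  dense*33^n≤ {n} L = begin
    dense (n , L) * 33 ^ n
      ≡⟨ ∑-*ʳ (subsets n) (33 ^ n) (λ B → ∑ (subsets n) λ A → ∑ (subsets n) (indicator A B)) ⟨
    ∑ (subsets n) (λ B → (∑ (subsets n) λ A → ∑ (subsets n) λ C → indicator A B C) * 33 ^ n)
      ≡⟨ ∑-cong (subsets n) (λ B → trans (∑-cong (subsets n) λ A → ∑-*ʳ (subsets n) (33 ^ n) _) (∑-*ʳ (subsets n) (33 ^ n) _)) ⟨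
    ∑ (subsets n) (λ B → ∑ (subsets n) λ A → ∑ (subsets n) λ C → indicator A B C * 33 ^ n)
      ≤⟨ ∑-mono (subsets n) (λ B → ∑-mono (subsets n) λ A → ∑-mono (subsets n) λ C → pointwise A B C) ⟩
    ∑ (subsets n) (λ B → ∑ (subsets n) λ A → ∑ (subsets n) λ C → 4 ^ n * 16 ^ ∣ B ∣ * (f A B * g B C))
      ≡⟨ ∑-cong (subsets n) (λ B → trans (∑-cong (subsets n) λ A → ∑-*ˡ (subsets n) (4 ^ n * 16 ^ ∣ B ∣) _)
           (trans (∑-*ˡ (subsets n) (4 ^ n * 16 ^ ∣ B ∣) _) (cong (4 ^ n * 16 ^ ∣ B ∣ *_)
             (trans (∑-∑-product (subsets n) (subsets n) (λ A → f A B) (g B)) (cong₂ _*_ (∑-translates (conjugate L) B) (∑-translates L B)))))) ⟩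
    ∑ (subsets n) (λ B → 4 ^ n * 16 ^ ∣ B ∣ * (n * 4 ^ ∣ ∁ B ∣ * (n * 4 ^ ∣ ∁ B ∣)))
      ≡⟨ ∑-cong (subsets n) (λ B → trans (rearrange (4 ^ n) (16 ^ ∣ B ∣) n (4 ^ ∣ ∁ B ∣))
           (cong (λ w → n ^ 2 * 4 ^ n * (16 ^ ∣ B ∣ * w)) (sym (^-distribʳ-* 4 4 ∣ ∁ B ∣)))) ⟩
    ∑ (subsets n) (λ B → n ^ 2 * 4 ^ n * (16 ^ ∣ B ∣ * 16 ^ ∣ ∁ B ∣))
      ≡⟨ trans (∑-*ˡ (subsets n) (n ^ 2 * 4 ^ n) _) (cong (n ^ 2 * 4 ^ n *_) (∑-binomial n 16 16)) ⟩
    n ^ 2 * 4 ^ n * 32 ^ n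
      ≡⟨ trans (*-assoc (n ^ 2) _ _) (cong (n ^ 2 *_) (sym (^-distribʳ-* 4 32 n))) ⟩
    n ^ 2 * 128 ^ n ∎
    where
    open ≤-Reasoning
    indicator : Subset n → Subset n → Subset n → ℕ
    indicator A B C = 𝟙 (3 * n ≤? 7 * ∣ A ∣) * (𝟙 (3 * n ≤? 7 * ∣ B ∣) * (𝟙 (3 * n ≤? 7 * ∣ C ∣) * 𝟙 (bad? L A B C)))
    f g : Subset n → Subset n → ℕ
    f A B = ∑ (points n) λ z → 𝟙 (A ⊆? ∁ (translate (conjugate L) z B)) * 3 ^ ∣ A ∣
    g B C = ∑ (points n) λ x → 𝟙 (C ⊆? ∁ (translate L x B)) * 3 ^ ∣ C ∣
    rearrange : ∀ u v n w → u * v * (n * w * (n * w)) ≡ n * (n * 1) * u * (v * (w * w))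
    rearrange = solve-∀
    select : ∀ (L : LatinSquare n) {x B C} → C ⊆ ∁ (translate L x B) →
             3 ^ ∣ C ∣ ≤ ∑ (points n) λ x → 𝟙 (C ⊆? ∁ (translate L x B)) * 3 ^ ∣ C ∣
    select L {x} {B} {C} h = begin
      3 ^ ∣ C ∣                                         ≡⟨ *-identityˡ _ ⟨
      1 * 3 ^ ∣ C ∣                                     ≡⟨ cong (_* 3 ^ ∣ C ∣) (𝟙-true (C ⊆? ∁ (translate L x B)) h) ⟨
      𝟙 (C ⊆? ∁ (translate L x B)) * 3 ^ ∣ C ∣          ≤⟨ term≤∑ (λ x → 𝟙 (C ⊆? ∁ (translate L x B)) * 3 ^ ∣ C ∣) (∈-allFin x) ⟩
      ∑ (points n) (λ x → 𝟙 (C ⊆? ∁ (translate L x B)) * 3 ^ ∣ C ∣) ∎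
    pointwise : ∀ A B C → indicator A B C * 33 ^ n ≤ 4 ^ n * 16 ^ ∣ B ∣ * (f A B * g B C)
    pointwise A B C = begin
      indicator A B C * 33 ^ n
        ≡⟨ trans (*-assoc (𝟙 dA) _ (33 ^ n)) (cong (𝟙 dA *_) (trans (*-assoc (𝟙 dB) _ (33 ^ n)) (cong (𝟙 dB *_) (*-assoc (𝟙 dC) _ (33 ^ n))))) ⟩
      𝟙 dA * (𝟙 dB * (𝟙 dC * (𝟙 (bad? L A B C) * 33 ^ n)))
        ≤⟨ 𝟙-* dA (λ hA → 𝟙-* dB λ hB → 𝟙-* dC λ hC → 𝟙-* (bad? L A B C)
             -- The point z of `C` confines `A` through the conjugate square, and the point x of `A`
             -- confines `C` through the square itself.
             λ { (((x , x∈A) , _ , (z , z∈C)) , av) → ≤-trans (33^n≤ n (∣ A ∣) (∣ B ∣) (∣ C ∣) hA hB hC)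
               (*-monoʳ-≤ (4 ^ n * 16 ^ ∣ B ∣) (*-mono-≤
                 (select (conjugate L) (avoids⇒⊆∁translate (conjugate L) (avoids-conjugate L av) z∈C))
                 (select L (avoids⇒⊆∁translate L av x∈A)))) }) ⟩
      4 ^ n * 16 ^ ∣ B ∣ * (f A B * g B C) ∎
      where
      dA : Dec (3 * n ≤ 7 * ∣ A ∣)
      dA = 3 * n ≤? 7 * ∣ A ∣
      dB : Dec (3 * n ≤ 7 * ∣ B ∣)
      dB = 3 * n ≤? 7 * ∣ B ∣
      dC : Dec (3 * n ≤ 7 * ∣ C ∣)
      dC = 3 * n ≤? 7 * ∣ C ∣

  -- Decay rates of the cases and their assembly

  sparse-negligible : Negligible proj₁ sparse
  sparse-negligible = polynomial*exponential-negligible proj₁ 0 12 (≤ᵇ⇒≤ 52 52 _) λ (n , L) → sparse*13^n≤ L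

  -- As 53 < 45^(3/7) · 60^(4/7), at most (105/53)ⁿ sets A have 7|A| ≤ 3n; M = 106 is the least M with
  -- (105/53) · 2(M + 1)/M < 4, and n^(16M) = n^1696 is the number of fingerprints.
  middle-negligible : Negligible proj₁ middle
  middle-negligible = polynomial*exponential-negligible proj₁ 1695 5617 (≤ᵇ⇒≤ 22471 22472 _) λ (n , L) → middle*[53M]^n≤ L 106

  dense-negligible : Negligible proj₁ dense
  dense-negligible = polynomial*exponential-negligible proj₁ 1 32 (≤ᵇ⇒≤ 129 132 _) λ (n , L) → dense*33^n≤ L

  small≤sparse+middle : ∀ i → small i ≤ sparse i + middle i
  small≤sparse+middle (n , L) = ≤-trans (∑-mono (subsets n) pointwise) (≤-reflexive (∑-+ (subsets n) _ _))
    where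
    split : ∀ {p q r} {P : Set p} {Q : Set q} {R : Set r} (d : Dec P) (e : Dec Q) (e′ : Dec R) F →
            (¬ Q → R) → 𝟙 d * F ≤ 𝟙 e * F + 𝟙 d * (𝟙 e′ * F)
    split d (yes _) e′ F h = ≤-trans (𝟙-* d λ _ → ≤-reflexive (sym (*-identityˡ F))) (m≤m+n _ _)
    split d (no ¬q) e′ F h = 𝟙-*-mono d λ _ →
      ≤-reflexive (sym (trans (cong (_* F) (𝟙-true e′ (h ¬q))) (*-identityˡ F)))
    pointwise : ∀ A → 𝟙 (7 * ∣ A ∣ ≤? 3 * n) * fibre L A ≤
      𝟙 (16 * ∣ A ∣ ≤? 1 * n) * fibre L A + 𝟙 (7 * ∣ A ∣ ≤? 3 * n) * (𝟙 (n ≤? 16 * ∣ A ∣) * fibre L A)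
    pointwise A = split (7 * ∣ A ∣ ≤? 3 * n) (16 * ∣ A ∣ ≤? 1 * n) (n ≤? 16 * ∣ A ∣) (fibre L A)
      λ 16∣A∣≰n → ≤-trans (≤-reflexive (sym (*-identityˡ n))) (≰⇒≥ 16∣A∣≰n)

  small-negligible : Negligible proj₁ small
  small-negligible = negligible-≤ proj₁ small≤sparse+middle (negligible-+ proj₁ sparse-negligible middle-negligible)

  -- Either one of the three sets has at most 3n/7 points, and the transpose or the conjugate brings
  -- it into the first position if necessary, or all three are dense. Interchanging the sums then
  -- restores the order in which `small` and `dense` are defined.
  total≤ : ∀ (L : LatinSquare n) →
    total (n , L) ≤ small (n , L) + small (n , transpose L) + small (n , conjugate L) + dense (n , L)
  total≤ {n} L = begin
    total (n , L)
      ≤⟨ ∑³-mono n pointwise ⟩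
    ∑³ n (λ A B C → f A B C + g B A C + h C B A + d B A C)
      ≡⟨ trans (∑³-+ n (λ A B C → f A B C + g B A C + h C B A) _)
        (cong (_+ ∑³ n (λ A B C → d B A C)) (trans (∑³-+ n (λ A B C → f A B C + g B A C) _)
          (cong (_+ ∑³ n (λ A B C → h C B A)) (∑³-+ n f _)))) ⟩
    ∑³ n f + ∑³ n (λ A B C → g B A C) + ∑³ n (λ A B C → h C B A) + ∑³ n (λ A B C → d B A C)
      ≡⟨ cong₂ _+_ (cong₂ _+_ (cong₂ _+_ (pull λ A B C → 𝟙 (bad? L A B C))
           (trans (∑³-swap₁₂ n g) (pull λ B A C → 𝟙 (bad? (transpose L) B A C))))
           (trans (∑³-swap₁₃ n h) (pull λ C B A → 𝟙 (bad? (conjugate L) C B A)))) (∑³-swap₁₂ n d) ⟩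
    small (n , L) + small (n , transpose L) + small (n , conjugate L) + dense (n , L) ∎
    where
    open ≤-Reasoning
    𝒫 : List (Subset n)
    𝒫 = subsets n
    f₀ : Subset n → ℕ
    f₀ A = 𝟙 (7 * ∣ A ∣ ≤? 3 * n)
    f g h d : Subset n → Subset n → Subset n → ℕ
    f A B C = f₀ A * 𝟙 (bad? L A B C)
    g B A C = f₀ B * 𝟙 (bad? (transpose L) B A C)
    h C B A = f₀ C * 𝟙 (bad? (conjugate L) C B A)
    d B A C = 𝟙 (3 * n ≤? 7 * ∣ A ∣) * (𝟙 (3 * n ≤? 7 * ∣ B ∣) * (𝟙 (3 * n ≤? 7 * ∣ C ∣) * 𝟙 (bad? L A B C)))
    pull : ∀ (φ : Subset n → Subset n → Subset n → ℕ) →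
           ∑³ n (λ A B C → f₀ A * φ A B C) ≡ ∑ 𝒫 (λ A → f₀ A * ∑ 𝒫 λ B → ∑ 𝒫 (φ A B))
    pull φ = ∑-cong 𝒫 λ A → trans (∑-cong 𝒫 λ B → ∑-*ˡ 𝒫 (f₀ A) (φ A B)) (∑-*ˡ 𝒫 (f₀ A) _)
    pointwise : ∀ A B C → 𝟙 (bad? L A B C) ≤ f A B C + g B A C + h C B A + d B A C
    pointwise A B C = 𝟙≤ (bad? L A B C)
      (cases (7 * ∣ A ∣ ≤? 3 * n) (7 * ∣ B ∣ ≤? 3 * n) (7 * ∣ C ∣ ≤? 3 * n))
      where
      1≤𝟙 : ∀ {p} {P : Set p} (d : Dec P) → P → 1 ≤ 𝟙 d
      1≤𝟙 d p = ≤-reflexive (sym (𝟙-true d p))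
      cases : Dec (7 * ∣ A ∣ ≤ 3 * n) → Dec (7 * ∣ B ∣ ≤ 3 * n) → Dec (7 * ∣ C ∣ ≤ 3 * n) →
              Bad L A B C → 1 ≤ f A B C + g B A C + h C B A + d B A C
      cases (yes a) _ _ bad = ≤-trans (*-mono-≤ (1≤𝟙 (7 * ∣ A ∣ ≤? 3 * n) a) (1≤𝟙 (bad? L A B C) bad))
        (≤-trans (m≤m+n _ _) (≤-trans (m≤m+n _ _) (m≤m+n (f A B C + g B A C + h C B A) _)))
      cases (no _) (yes b) _ bad = ≤-trans
        (*-mono-≤ (1≤𝟙 (7 * ∣ B ∣ ≤? 3 * n) b) (1≤𝟙 (bad? (transpose L) B A C) (bad-transpose L bad)))
        (≤-trans (m≤n+m _ (f A B C)) (≤-trans (m≤m+n _ _) (m≤m+n (f A B C + g B A C + h C B A) _)))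
      cases (no _) (no _) (yes c) bad = ≤-trans
        (*-mono-≤ (1≤𝟙 (7 * ∣ C ∣ ≤? 3 * n) c) (1≤𝟙 (bad? (conjugate L) C B A) (bad-conjugate L bad)))
        (≤-trans (m≤n+m _ (f A B C + g B A C)) (m≤m+n (f A B C + g B A C + h C B A) _))
      cases (no a) (no b) (no c) bad = ≤-trans
        (*-mono-≤ (1≤𝟙 (3 * n ≤? 7 * ∣ A ∣) (≰⇒≥ a)) (*-mono-≤ (1≤𝟙 (3 * n ≤? 7 * ∣ B ∣) (≰⇒≥ b))
          (*-mono-≤ (1≤𝟙 (3 * n ≤? 7 * ∣ C ∣) (≰⇒≥ c)) (1≤𝟙 (bad? L A B C) bad))))
        (m≤n+m _ (f A B C + g B A C + h C B A))

  total-negligible : Negligible proj₁ total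
  total-negligible = negligible-≤ proj₁ (λ (_ , L) → total≤ L)
    (negligible-+ proj₁ (negligible-+ proj₁ (negligible-+ proj₁
      small-negligible
      (negligible-∘ proj₁ (λ (n , L) → n , transpose L) (λ _ → refl) small-negligible))
      (negligible-∘ proj₁ (λ (n , L) → n , conjugate L) (λ _ → refl) small-negligible))
      dense-negligible)

  -- The cyclic group

  module _ (p : ℕ) .{{_ : NonZero p}} where

    _⊖_ : 𝔽 p → 𝔽 p → 𝔽 p
    z ⊖ y = (toℕ z + (p ∸ toℕ y)) mod p

    toℕ-mod : ∀ m → toℕ (m mod p) ≡ m % p
    toℕ-mod m = Fin.toℕ-fromℕ< (m%n<n m p)

    [m%p+n]%p≡[m+n]%p : ∀ m n → (m % p + n) % p ≡ (m + n) % p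
    [m%p+n]%p≡[m+n]%p m n = begin
      (m % p + n) % p              ≡⟨ %-distribˡ-+ (m % p) n p ⟩
      (m % p % p + n % p) % p      ≡⟨ cong (λ k → (k + n % p) % p) (m%n%n≡m%n m p) ⟩
      (m % p + n % p) % p          ≡⟨ %-distribˡ-+ m n p ⟨
      (m + n) % p                  ∎
      where open ≡-Reasoning

    -- Adding k and then l amounts to adding p. Taking y and p - y in either order yields both
    -- cancellation laws between addition and subtraction.
    mod-cancel : ∀ (x : 𝔽 p) k l → k + l ≡ p → (toℕ ((toℕ x + k) mod p) + l) mod p ≡ x
    mod-cancel x k l k+l≡p = Fin.toℕ-injective (begin
      toℕ ((toℕ ((toℕ x + k) mod p) + l) mod p)    ≡⟨ toℕ-mod (toℕ ((toℕ x + k) mod p) + l) ⟩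
      (toℕ ((toℕ x + k) mod p) + l) % p            ≡⟨ cong (λ m → (m + l) % p) (toℕ-mod (toℕ x + k)) ⟩
      ((toℕ x + k) % p + l) % p                    ≡⟨ [m%p+n]%p≡[m+n]%p (toℕ x + k) l ⟩
      (toℕ x + k + l) % p                          ≡⟨ cong (_% p) (trans (+-assoc (toℕ x) k l) (cong (toℕ x +_) k+l≡p)) ⟩
      (toℕ x + p) % p                              ≡⟨ [m+n]%n≡m%n (toℕ x) p ⟩
      toℕ x % p                                    ≡⟨ m<n⇒m%n≡m (Fin.toℕ<n x) ⟩
      toℕ x                                        ∎)
      where open ≡-Reasoning

    ⊕-comm : ∀ (x y : 𝔽 p) → x ⊕ y ≡ y ⊕ x
    ⊕-comm x y = cong (_mod p) (+-comm (toℕ x) (toℕ y))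

    ⊕-⊖ : ∀ x y → (x ⊕ y) ⊖ y ≡ x
    ⊕-⊖ x y = mod-cancel x (toℕ y) (p ∸ toℕ y) (m+[n∸m]≡n (<⇒≤ (Fin.toℕ<n y)))

    ⊖-⊕ : ∀ z y → (z ⊖ y) ⊕ y ≡ z
    ⊖-⊕ z y = mod-cancel z (p ∸ toℕ y) (toℕ y) (m∸n+n≡m (<⇒≤ (Fin.toℕ<n y)))

    cyclic : LatinSquare p
    cyclic = record
      { _∙_ = _⊕_ ; _\\_ = flip _⊖_ ; _//_ = _⊖_
      ; ∙-\\ = λ x z → trans (⊕-comm x (z ⊖ x)) (⊖-⊕ z x)
      ; \\-∙ = λ x y → trans (cong (_⊖ x) (⊕-comm x y)) (⊕-⊖ y x)
      ; //-∙ = ⊖-⊕ ; ∙-// = ⊕-⊖ }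

    sumFree⇒bad : ∀ {A B C} → ¬ A ⊆ ⊥ → ¬ B ⊆ ⊥ → ¬ C ⊆ ⊥ → SumFree (A , B , C) → Bad cyclic A B C
    sumFree⇒bad A⊈⊥ B⊈⊥ C⊈⊥ sf =
      (nonempty A⊈⊥ , nonempty B⊈⊥ , nonempty C⊈⊥) , λ x y x∈A y∈B x⊕y∈C → sf x y (x ⊕ y) x∈A y∈B x⊕y∈C refl
      where
      nonempty : ∀ {X : Subset p} → ¬ X ⊆ ⊥ → Nonempty X
      nonempty {X} X⊈⊥ with nonempty? X
      ... | yes X≠∅ = X≠∅
      ... | no  X=∅ = ⊥-elim (X⊈⊥ λ x∈X → contradiction (_ , x∈X) X=∅)

  -- Triples with an empty member

  ∑-subsets-const : ∀ n c → ∑ (subsets n) (λ _ → c) ≡ 2 ^ n * c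
  ∑-subsets-const zero    c = refl
  ∑-subsets-const (suc n) c = begin
    ∑ (subsets (suc n)) (λ _ → c)                          ≡⟨ ∑-subsets n (λ _ → c) ⟩
    ∑ (subsets n) (λ _ → c) + ∑ (subsets n) (λ _ → c)      ≡⟨ cong₂ _+_ (∑-subsets-const n c) (∑-subsets-const n c) ⟩
    2 ^ n * c + 2 ^ n * c                                  ≡⟨ double (2 ^ n) c ⟩
    2 ^ suc n * c                                          ∎
    where
    open ≡-Reasoning
    double : ∀ x c → x * c + x * c ≡ 2 * x * c
    double = solve-∀

  T≡∑³ : ∀ p → T p ≡ ∑³ p (λ A B C → 𝟙 (sumFree? (A , B , C)))
  T≡∑³ p = trans (length-filter sumFree? (triples p))
    (trans (∑-cartesianProductWith _,_ (subsets p) (cartesianProduct (subsets p) (subsets p)) (𝟙 ∘ sumFree?))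
      (∑-cong (subsets p) λ A → ∑-cartesianProductWith _,_ (subsets p) (subsets p) λ (B , C) → 𝟙 (sumFree? (A , B , C))))

  -- Emptiness is expressed as inclusion in `⊥`, so that `∑-powerset₁` counts it.
  empty : Subset n → ℕ
  empty A = 𝟙 (A ⊆? ⊥)

  ∑-empty : ∀ n → ∑ (subsets n) empty ≡ 1
  ∑-empty n = trans (∑-powerset₁ {n} ⊥) (cong (2 ^_) (∣⊥∣≡0 n))

  -- One shape for two counts: the constant weight 1 yields the 4^n triples with a given member
  -- empty, and the weight `empty C` the 2^n triples with two given members empty.
  ∑³-empty*const : ∀ n (w : Subset n → Subset n → ℕ) c → (∀ A → ∑ (subsets n) (w A) ≡ c) →
                   ∑³ n (λ A B C → empty A * w B C) ≡ 2 ^ n * c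
  ∑³-empty*const n w c h = begin
    ∑³ n (λ A B C → empty A * w B C)
      ≡⟨ ∑-cong (subsets n) (λ A → trans (∑-cong (subsets n) λ B → trans (∑-*ˡ (subsets n) (empty A) (w B)) (cong (empty A *_) (h B)))
           (∑-*ˡ (subsets n) (empty A) _)) ⟩
    ∑ (subsets n) (λ A → empty A * ∑ (subsets n) (λ _ → c))
      ≡⟨ ∑-*ʳ (subsets n) _ empty ⟩
    ∑ (subsets n) empty * ∑ (subsets n) (λ _ → c)
      ≡⟨ cong₂ _*_ (∑-empty n) (∑-subsets-const n c) ⟩
    1 * (2 ^ n * c)    ≡⟨ *-identityˡ _ ⟩
    2 ^ n * c          ∎
    where open ≡-Reasoning

  ∑³-empty : ∀ n → ∑³ n (λ A B C → empty A) ≡ 4 ^ n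
  ∑³-empty n = begin
    ∑³ n (λ A B C → empty A)          ≡⟨ ∑-cong (subsets n) (λ A → ∑-cong (subsets n) λ B → ∑-cong (subsets n) λ C → *-identityʳ (empty A)) ⟨
    ∑³ n (λ A B C → empty A * 1)      ≡⟨ ∑³-empty*const n (λ _ _ → 1) (2 ^ n) (λ _ → trans (∑-subsets-const n 1) (*-identityʳ _)) ⟩
    2 ^ n * 2 ^ n                     ≡⟨ ^-distribʳ-* 2 2 n ⟨
    4 ^ n                             ∎
    where open ≡-Reasoning

  ∑³-empty*empty : ∀ n → ∑³ n (λ A B C → empty A * empty C) ≡ 2 ^ n
  ∑³-empty*empty n = trans (∑³-empty*const n (λ _ → empty) 1 (λ _ → ∑-empty n)) (*-identityʳ _)

  ∑³-three-empty : ∀ n → ∑³ n (λ A B C → empty A + empty B + empty C) ≡ 3 * 4 ^ n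
  ∑³-three-empty n = begin
    ∑³ n (λ A B C → empty A + empty B + empty C)
      ≡⟨ trans (∑³-+ n (λ A B C → empty A + empty B) _) (cong (_+ ∑³ n (λ A B C → empty C)) (∑³-+ n (λ A B C → empty A) _)) ⟩
    ∑³ n (λ A B C → empty A) + ∑³ n (λ A B C → empty B) + ∑³ n (λ A B C → empty C)
      ≡⟨ cong₂ _+_ (cong₂ _+_ (∑³-empty n) (trans (∑³-swap₁₂ n λ A B C → empty A) (∑³-empty n)))
           (trans (∑³-swap₁₃ n λ A B C → empty A) (∑³-empty n)) ⟩
    4 ^ n + 4 ^ n + 4 ^ n       ≡⟨ triple (4 ^ n) ⟩
    3 * 4 ^ n                   ∎
    where
    open ≡-Reasoning
    triple : ∀ x → x + x + x ≡ 3 * x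
    triple = solve-∀

  module _ (p : ℕ) .{{_ : NonZero p}} where

    T≤3*4^p+total : T p ≤ 3 * 4 ^ p + total (p , cyclic p)
    T≤3*4^p+total = begin
      T p                                               ≡⟨ T≡∑³ p ⟩
      ∑³ p (λ A B C → 𝟙 (sumFree? (A , B , C)))
        ≤⟨ ∑³-mono p (λ A B C → pointwise (A ⊆? ⊥) (B ⊆? ⊥) (C ⊆? ⊥) (sumFree? (A , B , C)) (bad? (cyclic p) A B C) (sumFree⇒bad p)) ⟩
      ∑³ p (λ A B C → empty A + empty B + empty C + 𝟙 (bad? (cyclic p) A B C))
        ≡⟨ trans (∑³-+ p (λ A B C → empty A + empty B + empty C) _) (cong (_+ total (p , cyclic p)) (∑³-three-empty p)) ⟩
      3 * 4 ^ p + total (p , cyclic p)                  ∎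
      where
      open ≤-Reasoning
      pointwise : ∀ {P Q R S U : Set} (a : Dec P) (b : Dec Q) (c : Dec R) (s : Dec S) (u : Dec U) →
                  (¬ P → ¬ Q → ¬ R → S → U) → 𝟙 s ≤ 𝟙 a + 𝟙 b + 𝟙 c + 𝟙 u
      pointwise a       b       c       (no _)  u h = z≤n
      pointwise (yes _) b       c       (yes _) u h = s≤s z≤n
      pointwise (no _)  (yes _) c       (yes _) u h = s≤s z≤n
      pointwise (no _)  (no _)  (yes _) (yes _) u h = s≤s z≤n
      pointwise (no ¬a) (no ¬b) (no ¬c) (yes s) u h = ≤-reflexive (sym (𝟙-true u (h ¬a ¬b ¬c s)))

    -- Any triple with an empty member is sum-free, and Bonferroni's inequality bounds the
    -- overcount: k empty members satisfy k ≤ 1 + k(k - 1)/2 for k ≥ 1, and each of the three pairs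
    -- is empty in 2^p triples.
    3*4^p≤T+3*2^p : 3 * 4 ^ p ≤ T p + 3 * 2 ^ p
    3*4^p≤T+3*2^p = begin
      3 * 4 ^ p                                         ≡⟨ ∑³-three-empty p ⟨
      ∑³ p (λ A B C → empty A + empty B + empty C)
        ≤⟨ ∑³-mono p (λ A B C → pointwise (A ⊆? ⊥) (B ⊆? ⊥) (C ⊆? ⊥) (sumFree? (A , B , C))
             (λ A⊆⊥ x y z x∈A y∈B z∈C → contradiction (A⊆⊥ x∈A) ∉⊥)
             (λ B⊆⊥ x y z x∈A y∈B z∈C → contradiction (B⊆⊥ y∈B) ∉⊥)
             (λ C⊆⊥ x y z x∈A y∈B z∈C → contradiction (C⊆⊥ z∈C) ∉⊥)) ⟩
      ∑³ p (λ A B C → 𝟙 (sumFree? (A , B , C)) + empty A * empty B + empty A * empty C + empty B * empty C)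
        ≡⟨ trans (∑³-+ p (λ A B C → 𝟙 (sumFree? (A , B , C)) + empty A * empty B + empty A * empty C) _)
            (cong (_+ ∑³ p (λ A B C → empty B * empty C))
              (trans (∑³-+ p (λ A B C → 𝟙 (sumFree? (A , B , C)) + empty A * empty B) _)
                (cong (_+ ∑³ p (λ A B C → empty A * empty C)) (∑³-+ p (λ A B C → 𝟙 (sumFree? (A , B , C))) _)))) ⟩
      ∑³ p (λ A B C → 𝟙 (sumFree? (A , B , C))) + ∑³ p (λ A B C → empty A * empty B)
        + ∑³ p (λ A B C → empty A * empty C) + ∑³ p (λ A B C → empty B * empty C)
        ≡⟨ cong₂ _+_ (cong₂ _+_ (cong₂ _+_ (sym (T≡∑³ p))
             (trans (∑³-swap₂₃ p λ A B C → empty A * empty C) (∑³-empty*empty p)))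
             (∑³-empty*empty p)) (trans (∑³-swap₁₂ p λ A B C → empty A * empty C) (∑³-empty*empty p)) ⟩
      T p + 2 ^ p + 2 ^ p + 2 ^ p                       ≡⟨ triple (T p) (2 ^ p) ⟩
      T p + 3 * 2 ^ p                                   ∎
      where
      open ≤-Reasoning
      triple : ∀ t x → t + x + x + x ≡ t + 3 * x
      triple = solve-∀
      pointwise : ∀ {P Q R S : Set} (a : Dec P) (b : Dec Q) (c : Dec R) (s : Dec S) →
                  (P → S) → (Q → S) → (R → S) →
                  𝟙 a + 𝟙 b + 𝟙 c ≤ 𝟙 s + 𝟙 a * 𝟙 b + 𝟙 a * 𝟙 c + 𝟙 b * 𝟙 c
      pointwise (no _)  (no _)  (no _)  s       _ _ _ = z≤n
      pointwise (yes a) b       c       (no ¬s) f _ _ = contradiction (f a) ¬s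
      pointwise (no _)  (yes b) c       (no ¬s) _ g _ = contradiction (g b) ¬s
      pointwise (no _)  (no _)  (yes c) (no ¬s) _ _ h = contradiction (h c) ¬s
      pointwise (yes _) (yes _) (yes _) (yes _) _ _ _ = ≤ᵇ⇒≤ 3 4 _
      pointwise (yes _) (yes _) (no _)  (yes _) _ _ _ = ≤-refl
      pointwise (yes _) (no _)  (yes _) (yes _) _ _ _ = ≤-refl
      pointwise (yes _) (no _)  (no _)  (yes _) _ _ _ = ≤-refl
      pointwise (no _)  (yes _) (yes _) (yes _) _ _ _ = ≤-refl
      pointwise (no _)  (yes _) (no _)  (yes _) _ _ _ = ≤-refl
      pointwise (no _)  (no _)  (yes _) (yes _) _ _ _ = ≤-refl

  -- The absolute value becomes two inequalities free of subtraction, with the error E = `total` + 3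
  -- · 2^p. The second term is negligible with d = 0, that is, at rate 4 - 1 = 3.
  counting-bound : Σ[ d ∈ ℕ ] Σ[ K ∈ ℕ ] ∀ p .{{_ : NonZero p}} → Σ[ E ∈ ℕ ]
    T p ≤ 3 * 4 ^ p + E × 3 * 4 ^ p ≤ T p + E × E * suc d ^ p ≤ K * (3 + 4 * d) ^ p
  counting-bound = extract (negligible-+ proj₁ total-negligible 3*2^p-negligible)
    where
    3*2^p-negligible : Negligible {I = ∃ LatinSquare} proj₁ (λ (p , _) → 3 * 2 ^ p)
    3*2^p-negligible = negligible 0 3 λ (p , _) → begin
      3 * 2 ^ p * 1 ^ p     ≡⟨ trans (cong (3 * 2 ^ p *_) (^-zeroˡ p)) (*-identityʳ _) ⟩
      3 * 2 ^ p             ≤⟨ *-monoʳ-≤ 3 (^-monoˡ-≤ p (n≤1+n 2)) ⟩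
      3 * 3 ^ p             ∎
      where open ≤-Reasoning
    extract : Negligible {I = ∃ LatinSquare} proj₁ (λ (p , L) → total (p , L) + 3 * 2 ^ p) →
              Σ[ d ∈ ℕ ] Σ[ K ∈ ℕ ] ∀ p .{{_ : NonZero p}} → Σ[ E ∈ ℕ ]
              T p ≤ 3 * 4 ^ p + E × 3 * 4 ^ p ≤ T p + E × E * suc d ^ p ≤ K * (3 + 4 * d) ^ p
    extract (negligible d K h) = d , K , λ p → total (p , cyclic p) + 3 * 2 ^ p ,
      ≤-trans (T≤3*4^p+total p) (+-monoʳ-≤ (3 * 4 ^ p) (m≤m+n _ _)) ,
      ≤-trans (3*4^p≤T+3*2^p p) (+-monoʳ-≤ (T p) (m≤n+m (3 * 2 ^ p) (total (p , cyclic p)))) ,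
      h (p , cyclic p)

-- Rational form of the bound

open Defs using (_^_)
open import Data.Rational.Base using (ℚ; 0ℚ; 1ℚ; _≤_; _>_; _*_; _-_; _+_; -_; ∣_∣; _/_; toℚᵘ; Positive)
open Counting using (counting-bound)
open import Algebra.Properties.AbelianGroup ℚ.+-0-abelianGroup using (xyx⁻¹≈y; ⁻¹-anti-homo‿-)
open import Algebra.Properties.CommutativeSemiring.Exp (CommutativeRing.commutativeSemiring ℚ.+-*-commutativeRing) using (^-distrib-*)

toℚᵘ-/ : ∀ i d .{{_ : ℕ.NonZero d}} → toℚᵘ (i / d) ℚᵘ.≃ i ℚᵘ./ d
toℚᵘ-/ i (suc d) = ℚ.toℚᵘ-fromℚᵘ (ℚᵘ.mkℚᵘ i d)

fromℕ-+ : ∀ m n → fromℕ (m ℕ.+ n) ≡ fromℕ m + fromℕ n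
fromℕ-+ m n = ℚ.toℚᵘ-injective (begin
  toℚᵘ (fromℕ (m ℕ.+ n))                      ≈⟨ toℚᵘ-/ (ℤ.+ (m ℕ.+ n)) 1 ⟩
  ℤ.+ (m ℕ.+ n) ℚᵘ./ 1                        ≈⟨ ℚᵘ.*≡* (cong (ℤ._* ℤ.+ 1) (sym (cong₂ ℤ._+_ (ℤ.*-identityʳ (ℤ.+ m)) (ℤ.*-identityʳ (ℤ.+ n))))) ⟩
  (ℤ.+ m ℚᵘ./ 1) ℚᵘ.+ (ℤ.+ n ℚᵘ./ 1)          ≈⟨ ℚᵘ.+-cong (toℚᵘ-/ (ℤ.+ m) 1) (toℚᵘ-/ (ℤ.+ n) 1) ⟨
  toℚᵘ (fromℕ m) ℚᵘ.+ toℚᵘ (fromℕ n)          ≈⟨ ℚ.toℚᵘ-homo-+ (fromℕ m) (fromℕ n) ⟨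
  toℚᵘ (fromℕ m + fromℕ n)                    ∎)
  where open ℚᵘ.≃-Reasoning

fromℕ-* : ∀ m n → fromℕ (m ℕ.* n) ≡ fromℕ m * fromℕ n
fromℕ-* m n = ℚ.toℚᵘ-injective (begin
  toℚᵘ (fromℕ (m ℕ.* n))                      ≈⟨ toℚᵘ-/ (ℤ.+ (m ℕ.* n)) 1 ⟩
  ℤ.+ (m ℕ.* n) ℚᵘ./ 1                        ≈⟨ ℚᵘ.*≡* (cong (ℤ._* ℤ.+ 1) (ℤ.pos-* m n)) ⟩
  (ℤ.+ m ℚᵘ./ 1) ℚᵘ.* (ℤ.+ n ℚᵘ./ 1)          ≈⟨ ℚᵘ.*-cong (toℚᵘ-/ (ℤ.+ m) 1) (toℚᵘ-/ (ℤ.+ n) 1) ⟨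
  toℚᵘ (fromℕ m) ℚᵘ.* toℚᵘ (fromℕ n)          ≈⟨ ℚ.toℚᵘ-homo-* (fromℕ m) (fromℕ n) ⟨
  toℚᵘ (fromℕ m * fromℕ n)                    ∎)
  where open ℚᵘ.≃-Reasoning

fromℕ-^ : ∀ m n → fromℕ (m ℕ.^ n) ≡ fromℕ m ^ n
fromℕ-^ m zero    = refl
fromℕ-^ m (suc n) = trans (fromℕ-* m (m ℕ.^ n)) (cong (fromℕ m *_) (fromℕ-^ m n))

fromℕ-mono : ∀ {m n} → m ℕ.≤ n → fromℕ m ≤ fromℕ n
fromℕ-mono {m} {n} m≤n = ℚ.toℚᵘ-cancel-≤ (begin
  toℚᵘ (fromℕ m)    ≃⟨ toℚᵘ-/ (ℤ.+ m) 1 ⟩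
  ℤ.+ m ℚᵘ./ 1      ≤⟨ ℚᵘ.*≤* (ℤ.*-monoʳ-≤-nonNeg (ℤ.+ 1) (ℤ.+≤+ m≤n)) ⟩
  ℤ.+ n ℚᵘ./ 1      ≃⟨ toℚᵘ-/ (ℤ.+ n) 1 ⟨
  toℚᵘ (fromℕ n)    ∎)
  where open ℚᵘ.≤-Reasoning

1/n*n≡1 : ∀ n .{{_ : ℕ.NonZero n}} → (ℤ.+ 1 / n) * fromℕ n ≡ 1ℚ
1/n*n≡1 n@(suc _) = ℚ.toℚᵘ-injective (begin
  toℚᵘ ((ℤ.+ 1 / n) * fromℕ n)                 ≈⟨ ℚ.toℚᵘ-homo-* (ℤ.+ 1 / n) (fromℕ n) ⟩
  toℚᵘ (ℤ.+ 1 / n) ℚᵘ.* toℚᵘ (fromℕ n)         ≈⟨ ℚᵘ.*-cong (toℚᵘ-/ (ℤ.+ 1) n) (toℚᵘ-/ (ℤ.+ n) 1) ⟩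
  (ℤ.+ 1 ℚᵘ./ n) ℚᵘ.* (ℤ.+ n ℚᵘ./ 1)           ≈⟨ ℚᵘ.*≡* (ℤ.*-assoc (ℤ.+ 1) (ℤ.+ n) (ℤ.+ 1)) ⟩
  toℚᵘ 1ℚ                                      ∎)
  where open ℚᵘ.≃-Reasoning

∣p-q∣≤r : ∀ {p q r} → p ≤ q + r → q ≤ p + r → ∣ p - q ∣ ≤ r
∣p-q∣≤r {p} {q} {r} p≤q+r q≤p+r with ℚ.∣p∣≡p∨∣p∣≡-p (p - q)
... | inj₁ eq = begin
  ∣ p - q ∣      ≡⟨ eq ⟩
  p - q          ≤⟨ ℚ.+-monoˡ-≤ (- q) p≤q+r ⟩
  q + r - q      ≡⟨ xyx⁻¹≈y q r ⟩
  r              ∎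
  where open ℚ.≤-Reasoning
... | inj₂ eq = begin
  ∣ p - q ∣      ≡⟨ eq ⟩
  - (p - q)      ≡⟨ ⁻¹-anti-homo‿- p q ⟩
  q - p          ≤⟨ ℚ.+-monoˡ-≤ (- p) q≤p+r ⟩
  p + r - p      ≡⟨ xyx⁻¹≈y p r ⟩
  r              ∎
  where open ℚ.≤-Reasoning

[4-1/D]*D≡4D-1 : ∀ d → (fromℕ 4 - ℤ.+ 1 / suc d) * fromℕ (suc d) ≡ fromℕ (3 ℕ.+ 4 ℕ.* d)
[4-1/D]*D≡4D-1 d = begin
  (fromℕ 4 - c) * D                       ≡⟨ ℚ.*-distribʳ-+ D (fromℕ 4) (- c) ⟩
  fromℕ 4 * D + - c * D                   ≡⟨ cong₂ _+_ (sym (fromℕ-* 4 (suc d))) (sym (ℚ.neg-distribˡ-* c D)) ⟩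
  fromℕ (4 ℕ.* suc d) - c * D             ≡⟨ cong₂ (λ m q → fromℕ m - q) (ℕ.*-suc 4 d) (1/n*n≡1 (suc d)) ⟩
  fromℕ (4 ℕ.+ 4 ℕ.* d) - 1ℚ              ≡⟨ cong (_- 1ℚ) (fromℕ-+ 1 (3 ℕ.+ 4 ℕ.* d)) ⟩
  1ℚ + fromℕ (3 ℕ.+ 4 ℕ.* d) - 1ℚ         ≡⟨ xyx⁻¹≈y 1ℚ _ ⟩
  fromℕ (3 ℕ.+ 4 ℕ.* d)                   ∎
  where
  open ≡-Reasoning
  c D : ℚ
  c = ℤ.+ 1 / suc d
  D = fromℕ (suc d)

-- Multiplication by (1 + d)^p clears the denominators of (4 - 1/(1 + d))^p and leads back to
-- natural numbers. Passing from K to 1 + K makes the constant positive.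
fromℕ-bound : ∀ E K d p → E ℕ.* suc d ℕ.^ p ℕ.≤ K ℕ.* (3 ℕ.+ 4 ℕ.* d) ℕ.^ p →
              fromℕ E ≤ fromℕ (suc K) * (fromℕ 4 - ℤ.+ 1 / suc d) ^ p
fromℕ-bound E K d p h = ℚ.*-cancelʳ-≤-pos (fromℕ (suc d ℕ.^ p)) {{Dᵖ>0}} (begin
  fromℕ E * fromℕ (suc d ℕ.^ p)                   ≡⟨ fromℕ-* E (suc d ℕ.^ p) ⟨
  fromℕ (E ℕ.* suc d ℕ.^ p)                       ≤⟨ fromℕ-mono (ℕ.≤-trans h (ℕ.*-monoˡ-≤ _ (ℕ.n≤1+n K))) ⟩
  fromℕ (suc K ℕ.* (3 ℕ.+ 4 ℕ.* d) ℕ.^ p)         ≡⟨ fromℕ-* (suc K) ((3 ℕ.+ 4 ℕ.* d) ℕ.^ p) ⟩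
  fromℕ (suc K) * fromℕ ((3 ℕ.+ 4 ℕ.* d) ℕ.^ p)   ≡⟨ cong (fromℕ (suc K) *_) (fromℕ-^ (3 ℕ.+ 4 ℕ.* d) p) ⟩
  fromℕ (suc K) * fromℕ (3 ℕ.+ 4 ℕ.* d) ^ p       ≡⟨ cong (λ x → fromℕ (suc K) * x ^ p) ([4-1/D]*D≡4D-1 d) ⟨
  fromℕ (suc K) * (b * fromℕ (suc d)) ^ p         ≡⟨ cong (fromℕ (suc K) *_) (^-distrib-* b (fromℕ (suc d)) p) ⟩
  fromℕ (suc K) * (b ^ p * fromℕ (suc d) ^ p)     ≡⟨ cong (λ x → fromℕ (suc K) * (b ^ p * x)) (fromℕ-^ (suc d) p) ⟨
  fromℕ (suc K) * (b ^ p * fromℕ (suc d ℕ.^ p))   ≡⟨ ℚ.*-assoc (fromℕ (suc K)) (b ^ p) _ ⟨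
  fromℕ (suc K) * b ^ p * fromℕ (suc d ℕ.^ p)     ∎)
  where
  open ℚ.≤-Reasoning
  b : ℚ
  b = fromℕ 4 - ℤ.+ 1 / suc d
  Dᵖ>0 : Positive (fromℕ (suc d ℕ.^ p))
  Dᵖ>0 = ℚ.normalize-pos (suc d ℕ.^ p) 1 {{_}} {{ℕ.m^n≢0 (suc d) p}}

theorem4 : Σ[ c ∈ ℚ ] Σ[ K ∈ ℚ ] Σ[ p₀ ∈ ℕ ]
    (c > 0ℚ × K > 0ℚ ×
    ((p : ℕ) → Prime p → p ≥ⁿ p₀ →
    ∣ fromℕ (T p) - fromℕ 3 * fromℕ 4 ^ p ∣ ≤ K * (fromℕ 4 - c) ^ p))
theorem4 = from-counting counting-bound
  where
  from-counting : Σ[ d ∈ ℕ ] Σ[ K ∈ ℕ ] (∀ p .{{_ : ℕ.NonZero p}} → Σ[ E ∈ ℕ ]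
      T p ℕ.≤ 3 ℕ.* 4 ℕ.^ p ℕ.+ E × 3 ℕ.* 4 ℕ.^ p ℕ.≤ T p ℕ.+ E × E ℕ.* suc d ℕ.^ p ℕ.≤ K ℕ.* (3 ℕ.+ 4 ℕ.* d) ℕ.^ p) →
    Σ[ c ∈ ℚ ] Σ[ K ∈ ℚ ] Σ[ p₀ ∈ ℕ ] (c > 0ℚ × K > 0ℚ × ((p : ℕ) → Prime p → p ≥ⁿ p₀ →
      ∣ fromℕ (T p) - fromℕ 3 * fromℕ 4 ^ p ∣ ≤ K * (fromℕ 4 - c) ^ p))
  from-counting (d , K , h) =
    -- The constant absorbs the small cases, so the threshold can be 0, while c = 1/(1 + d) is the
    -- gap recorded by negligibility.
    ℤ.+ 1 / suc d , fromℕ (suc K) , 0 ,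
    ℚ.positive⁻¹ _ {{ℚ.normalize-pos 1 (suc d)}} , ℚ.positive⁻¹ _ {{ℚ.normalize-pos (suc K) 1}} , bound
    where
    bound : (p : ℕ) → Prime p → p ≥ⁿ 0 →
      ∣ fromℕ (T p) - fromℕ 3 * fromℕ 4 ^ p ∣ ≤ fromℕ (suc K) * (fromℕ 4 - ℤ.+ 1 / suc d) ^ p
    bound p p-prime _ = let E , T≤ , ≤T , E-small = h p {{prime⇒nonZero p-prime}} in
      ℚ.≤-trans (∣p-q∣≤r (subst (fromℕ (T p) ≤_) (trans (fromℕ-+ (3 ℕ.* 4 ℕ.^ p) E) (cong (_+ fromℕ E) main-term)) (fromℕ-mono T≤))
                         (subst₂ _≤_ main-term (fromℕ-+ (T p) E) (fromℕ-mono ≤T)))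
                (fromℕ-bound E K d p E-small)
      where
      main-term : fromℕ (3 ℕ.* 4 ℕ.^ p) ≡ fromℕ 3 * fromℕ 4 ^ p
      main-term = trans (fromℕ-* 3 (4 ℕ.^ p)) (cong (fromℕ 3 *_) (fromℕ-^ 4 p))
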